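{- Every graph that is isomorphic to an induced subgraph of some unigraph is apex-perfect. Consequently, every such graph $G$ satisfies $\chi(G)\le\omega(G)+1$.
   Context: All graphs are finite and simple; $\omega$ denotes the clique number and $\chi$ the chromatic number. A unigraph is a graph $G$ such that every graph with the same degree sequence as $G$ is isomorphic to $G$. A graph $G$ is apex-perfect if there exists a vertex $v\in V(G)$ such that $G-\{v\}$ is perfect. -}

module Defs where

open import Data.Nat using (ℕ; zero; suc; _≤_; _+_)
open import Data.Fin using (Fin; punchIn)
open import Data.Bool using (Bool; true; false)
open import Data.Product using (Σ; _×_; ∃)
open import Data.List using (List; filter; length)
open import Data.List using () renaming (allFin to allFinL)
open import Data.Bool using (T)
open import Relation.Binary.PropositionalEquality using (_≡_; _≢_)
open import Function.Bundles using (_↔_; Inverse)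
open import Relation.Nullary.Decidable using (does)
open import Data.Bool.Properties using (T?)

record Graph (n : ℕ) : Set where
  field
    adj    : Fin n → Fin n → Bool
    sym    : ∀ i j → adj i j ≡ adj j i
    irrefl : ∀ i → adj i i ≡ false
open Graph public

degree : ∀ {n} → Graph n → Fin n → ℕ
degree {n} G i = length (filter (λ j → T? (adj G i j)) (allFinL n))

-- G and H have the same degree sequence (as multisets): some permutation
-- of the vertices matches degrees. (Graphs of different orders never
-- have the same degree sequence.)
SameDegSeq : ∀ {n} → Graph n → Graph n → Set
SameDegSeq {n} G H =
  Σ (Fin n ↔ Fin n) λ σ → ∀ i → degree H (Inverse.to σ i) ≡ degree G i

_≅_ : ∀ {n m} → Graph n → Graph m → Set
_≅_ {n} {m} G H =
  Σ (Fin n ↔ Fin m) λ f → ∀ i j → adj G i j ≡ adj H (Inverse.to f i) (Inverse.to f j)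

Unigraph : ∀ {n} → Graph n → Set
Unigraph {n} G = (H : Graph n) → SameDegSeq G H → G ≅ H

_⊑ind_ : ∀ {m n} → Graph m → Graph n → Set
_⊑ind_ {m} {n} G H =
  Σ (Fin m → Fin n) λ f →
    (∀ i j → f i ≡ f j → i ≡ j) × (∀ i j → adj G i j ≡ adj H (f i) (f j))

HasClique : ∀ {n} → Graph n → ℕ → Set
HasClique {n} G k =
  Σ (Fin k → Fin n) λ c →
    (∀ i j → c i ≡ c j → i ≡ j) × (∀ i j → i ≢ j → adj G (c i) (c j) ≡ true)

Colorable : ∀ {n} → Graph n → ℕ → Set
Colorable {n} G k =
  Σ (Fin n → Fin k) λ col → ∀ i j → adj G i j ≡ true → col i ≢ col j

IsCliqueNumber : ∀ {n} → Graph n → ℕ → Set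
IsCliqueNumber G a = HasClique G a × (∀ b → HasClique G b → b ≤ a)

IsChromaticNumber : ∀ {n} → Graph n → ℕ → Set
IsChromaticNumber G b = Colorable G b × (∀ c → Colorable G c → b ≤ c)

Perfect : ∀ {n} → Graph n → Set
Perfect G = ∀ k (H : Graph k) → H ⊑ind G →
  ∀ a b → IsCliqueNumber H a → IsChromaticNumber H b → a ≡ b

delete : ∀ {n} → Graph (suc n) → Fin (suc n) → Graph n
delete G v = record
  { adj    = λ i j → adj G (punchIn v i) (punchIn v j)
  ; sym    = λ i j → sym G (punchIn v i) (punchIn v j)
  ; irrefl = λ i → irrefl G (punchIn v i)
  }

ApexPerfect : ∀ {n} → Graph (suc n) → Set
ApexPerfect {n} G = ∃ λ (v : Fin (suc n)) → Perfect (delete G v)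

{-# OPTIONS --safe #-}
module Submission where

-- A graph whose vertices are ordered so that no induced path abcd has a before b and d before c is
-- perfect (Chvátal): greedy colouring in this order uses as many colours as some clique has vertices.
-- In a unigraph U, ordering the vertices by decreasing degree, with ties broken recursively inside the
-- unigraphs induced by the degree classes, is such an order unless U has an induced pentagon: 2-switches
-- and edge transfers preserving the degree sequence also preserve all isomorphism invariants, and this
-- forces the four vertices of an offending path to have the same degree. So everything reduces to a regular
-- unigraph; being isomorphic to a circulant graph or its complement, it is vertex-transitive, and then each of
-- its induced paths abcd closes up to a pentagon which is the whole graph. Finally, if U has an induced
-- pentagon, the vertices off it are complete or anticomplete to it, the former forming a clique and
-- the latter an independent set, so deleting one pentagon vertex leaves a split graph.

open import Defs
import Data.Bool.Properties as Bool
import Data.Nat.Properties as ℕ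
open import Algebra.Properties.CommutativeMonoid.Sum ℕ.+-0-commutativeMonoid using (sum; sum-cong-≗; sum-permute; ∑-distrib-+)
open import Data.Bool using (Bool; true; false; T; _∧_; _∨_; not; _xor_; if_then_else_)
open import Data.Bool.Properties using (T?; ∧-zeroʳ; ∧-identityʳ; ∧-comm; not-involutive; not-injective)
open import Data.Empty using (⊥; ⊥-elim)
open import Data.Fin using (Fin; zero; suc; toℕ; fromℕ<; inject₁; punchIn; punchOut)
open import Data.Fin.Induction using (<-weakInduction)
open import Data.Fin.Permutation using (transpose)
open import Data.Fin.Properties using (_≟_; all?; any?; injective⇒≤; punchIn-injective; punchIn-punchOut; punchInᵢ≢i; punchOut-injective; toℕ-fromℕ<; toℕ-inject₁; toℕ-injective; toℕ<n) renaming (suc-injective to Fin-suc-injective)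
open import Data.List using (filter; length; tabulate)
open import Data.Nat using (ℕ; zero; suc; _+_; _*_; _∸_; ∣_-_∣; _≤_; _<_; z≤n; s≤s; s≤s⁻¹; _≤?_; _<?_)
open import Data.Nat.Divisibility using (_∣_; divides; _∣0; ∣-refl; ∣m∣n⇒∣m+n; ∣m+n∣m⇒∣n)
open import Data.Nat.Primality using (euclidsLemma; prime[2])
open import Data.Nat.Properties using (*-comm; +-assoc; +-cancelˡ-<; +-cancelˡ-≡; +-comm; +-identityʳ; +-mono-<-≤; +-mono-≤; +-mono-≤-<; +-suc; 1+n≢n; 1+n≰n; <-irrefl; <-trans; <-≤-trans; <⇒≢; <⇒≤; m+[n∸m]≡n; m≤n⇒m<n∨m≡n; n<1+n; suc-injective; ≤-<-trans; ≤-antisym; ≤-refl; ≤-total; ≤-trans; ≤⇒≯; ≤∧≢⇒<; ≮⇒≥)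
open import Data.Product using (∃; ∃₂; _×_; _,_; proj₁; proj₂)
open import Data.Sum using (_⊎_; inj₁; inj₂)
open import Function.Base using (_∘_; id)
open import Function.Bundles using (_↔_; Inverse; mk↔ₛ′)
open import Function.Construct.Composition using (_↔-∘_)
open import Function.Construct.Identity using (↔-id)
open import Function.Construct.Symmetry using (↔-sym)
open import Relation.Binary.Definitions using (tri<; tri≈; tri>)
open import Relation.Binary.PropositionalEquality using (_≡_; _≢_; refl; cong; cong₂; subst; subst₂; trans) renaming (sym to ≡-sym)
open import Relation.Nullary using (¬_; Dec; yes; no; does)
open import Relation.Nullary.Decidable using (dec-true; dec-false; decidable-stable; map′; ¬?; _×-dec_; _⊎-dec_)

-- The five-cycle is a unigraph with clique number 2 and chromatic number 3: pentagons cannot be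
-- excluded, and the bound is attained. In the switching arguments nothing is known about the
-- isomorphism onto the modified graph except that it exists, so it is only used to compare counts:
-- each modification destroys some configuration and creates none, or the reverse. What is counted
-- are edges between two given degrees, vertices of given inner degree in a degree class and, in a
-- regular graph, where degrees say nothing, the triangles at a vertex; the last count is usable
-- because some realisation has a rotation, which makes it the same at every vertex. Unigraphs are
-- closed under complement and under passing to a degree class, since another realisation of the
-- class could be grafted into the whole graph. The first closure settles many cases by duality. The
-- second lets inner degrees be treated as degrees and carries the recursions, a degree class of a
-- nonregular graph being smaller than the graph.

true≢false : ∀ {b} → b ≡ true → b ≡ false → ⊥
true≢false refl ()

¬true⇒false : ∀ {b} → ¬ (b ≡ true) → b ≡ false
¬true⇒false {false} _ = refl
¬true⇒false {true}  h = ⊥-elim (h refl)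

≡true? : ∀ b → Dec (b ≡ true)
≡true? b = b Bool.≟ true

bool-ext : ∀ {b c} → (b ≡ true → c ≡ true) → (c ≡ true → b ≡ true) → b ≡ c
bool-ext {true}  {c}     f g = ≡-sym (f refl)
bool-ext {false} {true}  f g = g refl
bool-ext {false} {false} f g = refl

∧-true : ∀ {b c} → b ∧ c ≡ true → b ≡ true × c ≡ true
∧-true {true} {true} _ = refl , refl

∧-intro : ∀ {b c} → b ≡ true → c ≡ true → b ∧ c ≡ true
∧-intro refl refl = refl

does-sound : ∀ {A : Set} (d : Dec A) → does d ≡ true → A
does-sound (yes a) _ = a

infix 4 _==_
_==_ : ∀ {n} → Fin n → Fin n → Bool
i == j = does (i ≟ j)

==-refl : ∀ {n} (i : Fin n) → (i == i) ≡ true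
==-refl i = dec-true (i ≟ i) refl

==-≢ : ∀ {n} {i j : Fin n} → i ≢ j → (i == j) ≡ false
==-≢ {i = i} {j} = dec-false (i ≟ j)

-- A sum type rather than Dec, so that with-abstracting on it leaves _==_ in the goal alone.
eq? : ∀ {n} (i j : Fin n) → i ≡ j ⊎ i ≢ j
eq? i j with i ≟ j
... | yes p = inj₁ p
... | no p  = inj₂ p

-- Counting

sum-mono : ∀ {n} {f g : Fin n → ℕ} → (∀ i → f i ≤ g i) → sum f ≤ sum g
sum-mono {zero}  h = z≤n
sum-mono {suc n} h = +-mono-≤ (h zero) (sum-mono (h ∘ suc))

sum-strict : ∀ {n} {f g : Fin n → ℕ} → (∀ i → f i ≤ g i) → ∀ x → f x < g x → sum f < sum g
sum-strict h zero    lt = +-mono-<-≤ lt (sum-mono (h ∘ suc))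
sum-strict h (suc x) lt = +-mono-≤-< (h zero) (sum-strict (h ∘ suc) x lt)

bit : Bool → ℕ
bit true  = 1
bit false = 0

bit-mono : ∀ {b c} → (b ≡ true → c ≡ true) → bit b ≤ bit c
bit-mono {false} h = z≤n
bit-mono {true}  h rewrite h refl = ≤-refl

bit-strict : ∀ {b c} → b ≡ false → c ≡ true → bit b < bit c
bit-strict refl refl = s≤s z≤n

opaque
  count : ∀ {n} → (Fin n → Bool) → ℕ
  count P = sum (bit ∘ P)

  count-cong : ∀ {n} {P Q : Fin n → Bool} → (∀ i → P i ≡ Q i) → count P ≡ count Q
  count-cong h = sum-cong-≗ (λ i → cong bit (h i))

  count-mono : ∀ {n} {P Q : Fin n → Bool} → (∀ i → P i ≡ true → Q i ≡ true) → count P ≤ count Q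
  count-mono h = sum-mono (λ i → bit-mono (h i))

  count-strict : ∀ {n} {P Q : Fin n → Bool} → (∀ i → P i ≡ true → Q i ≡ true) →
                 ∀ x → P x ≡ false → Q x ≡ true → count P < count Q
  count-strict h x p q = sum-strict (λ i → bit-mono (h i)) x (bit-strict p q)

  count-permute : ∀ {m n} (P : Fin n → Bool) (π : Fin m ↔ Fin n) → count (P ∘ Inverse.to π) ≡ count P
  count-permute P π = ≡-sym (sum-permute (bit ∘ P) π)

  count-remove : ∀ {n} {P Q : Fin n → Bool} j → (∀ i → i ≢ j → P i ≡ Q i) → P j ≡ true → Q j ≡ false →
                 count P ≡ suc (count Q)
  count-remove {P = P} {Q} zero h p q rewrite p | q = cong suc (count-cong (λ i → h (suc i) λ ()))
  count-remove {P = P} {Q} (suc j) h p q rewrite h zero (λ ()) =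
    trans (cong (bit (Q zero) +_)
            (count-remove j (λ i i≢j → h (suc i) (λ { refl → i≢j refl })) p q))
          (+-suc (bit (Q zero)) _)

  count-split : ∀ {n} (K P : Fin n → Bool) →
                count P ≡ count (λ i → K i ∧ P i) + count (λ i → not (K i) ∧ P i)
  count-split K P = trans (sum-cong-≗ pt) (∑-distrib-+ (λ i → bit (K i ∧ P i)) (λ i → bit (not (K i) ∧ P i)))
    where
    pt : ∀ i → bit (P i) ≡ bit (K i ∧ P i) + bit (not (K i) ∧ P i)
    pt i with K i | P i
    ... | true  | true  = refl
    ... | true  | false = refl
    ... | false | true  = refl
    ... | false | false = refl

  count-complement : ∀ {n} (P : Fin n → Bool) → count P + count (not ∘ P) ≡ n
  count-complement {zero}  P = refl
  count-complement {suc n} P with P zero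
  ... | true  = cong suc (count-complement (P ∘ suc))
  ... | false = trans (+-suc _ _) (cong suc (count-complement (P ∘ suc)))

count-pick : ∀ {n} (P Q : Fin n → Bool) → count Q < count P → ∃ λ i → P i ≡ true × Q i ≡ false
count-pick P Q lt with any? (λ i → (P i Bool.≟ true) ×-dec (Q i Bool.≟ false))
... | yes r = r
... | no ¬r = ⊥-elim (≤⇒≯ (count-mono sub) lt)
  where
  sub : ∀ i → P i ≡ true → Q i ≡ true
  sub i p with Q i in eq
  ... | true  = refl
  ... | false = ⊥-elim (¬r (i , p , eq))

infixl 5 _−_
_−_ : ∀ {n} → (Fin n → Bool) → Fin n → (Fin n → Bool)
(P − j) i = P i ∧ not (i == j)

−-hit : ∀ {n} (P : Fin n → Bool) j → (P − j) j ≡ false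
−-hit P j rewrite ==-refl j = ∧-zeroʳ (P j)

−-miss : ∀ {n} (P : Fin n → Bool) {i j} → i ≢ j → (P − j) i ≡ P i
−-miss P {i} i≢j rewrite ==-≢ i≢j = ∧-identityʳ (P i)

−-true : ∀ {n} (P : Fin n → Bool) {i j} → (P − j) i ≡ true → P i ≡ true × i ≢ j
−-true P {i} {j} h = proj₁ (∧-true h) , λ { refl → true≢false h (−-hit P i) }

count-− : ∀ {n} (P : Fin n → Bool) {j} → P j ≡ true → count P ≡ suc (count (P − j))
count-− P {j} p = count-remove j (λ i i≢j → ≡-sym (−-miss P i≢j)) p (−-hit P j)

count-exchange : ∀ {n} {P Q : Fin n → Bool} j k → (∀ i → i ≢ j → i ≢ k → P i ≡ Q i) →
                 P j ≡ true → Q j ≡ false → P k ≡ false → Q k ≡ true → count P ≡ count Q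
count-exchange {P = P} {Q} j k h pj qj pk qk =
  trans (count-− P pj) (≡-sym (count-remove k agree qk off))
  where
  agree : ∀ i → i ≢ k → Q i ≡ (P − j) i
  agree i i≢k with i ≟ j
  ... | yes refl = trans qj (≡-sym (∧-zeroʳ (P i)))
  ... | no i≢j   = trans (≡-sym (h i i≢j i≢k)) (≡-sym (∧-identityʳ (P i)))
  off : (P − j) k ≡ false
  off rewrite pk = refl

-- A permutation cannot carry a finite set onto a proper subset of itself.
noProper : ∀ {n} (π : Fin n ↔ Fin n) (P P′ : Fin n → Bool) →
           (∀ i → P i ≡ P′ (Inverse.to π i)) →
           (∀ i → P′ i ≡ true → P i ≡ true) →
           ∀ x → P x ≡ true → P′ x ≡ false → ⊥
noProper π P P′ eq sub x p p′ = <-irrefl (≡-sym (trans (count-cong eq) (count-permute P′ π)))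
  (count-strict sub x p′ p)

opaque
  count₂ : ∀ {n} → (Fin n → Fin n → Bool) → ℕ
  count₂ P = sum (count ∘ P)

  count₂-permute : ∀ {m n} (π : Fin m ↔ Fin n) (P : Fin m → Fin m → Bool) (P′ : Fin n → Fin n → Bool) →
                   (∀ i j → P i j ≡ P′ (Inverse.to π i) (Inverse.to π j)) → count₂ P ≡ count₂ P′
  count₂-permute π P P′ eq =
    trans (sum-cong-≗ (λ i → trans (count-cong (eq i)) (count-permute (P′ (Inverse.to π i)) π)))
          (≡-sym (sum-permute (count ∘ P′) π))

  count₂-strict : ∀ {n} (P Q : Fin n → Fin n → Bool) → (∀ i j → P i j ≡ true → Q i j ≡ true) →
                  ∀ x y → P x y ≡ false → Q x y ≡ true → count₂ P < count₂ Q
  count₂-strict P Q sub x y p q =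
    sum-strict (λ i → count-mono (sub i)) x (count-strict (sub x) y p q)

dg : ∀ {n} → Graph n → Fin n → ℕ
dg G v = count (adj G v)

opaque
  unfolding count

  degree≡dg : ∀ {n} (G : Graph n) v → degree G v ≡ dg G v
  degree≡dg {n} G v = go n id
    where
    -- The list of all vertices is a tabulation, so the induction runs over an arbitrary `e`.
    go : ∀ k (e : Fin k → Fin n) →
         length (filter (λ u → T? (adj G v u)) (tabulate e)) ≡ count (adj G v ∘ e)
    go zero    e = refl
    go (suc k) e with adj G v (e zero)
    ... | true  = cong suc (go k (e ∘ suc))
    ... | false = go k (e ∘ suc)

flip : ∀ {n} (G : Graph n) {u v b} → adj G u v ≡ b → adj G v u ≡ b
flip G {u} {v} h = trans (sym G v u) h

edge-≢ : ∀ {n} (G : Graph n) {u v} → adj G u v ≡ true → u ≢ v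
edge-≢ G {u} h refl = true≢false h (irrefl G u)

row-≢ : ∀ {n} (G : Graph n) {u v w} → adj G u w ≡ true → adj G v w ≡ false → u ≢ v
row-≢ G h k refl = true≢false h k

col-≢ : ∀ {n} (G : Graph n) {u v w} → adj G w u ≡ true → adj G w v ≡ false → u ≢ v
col-≢ G h k refl = true≢false h k

≅-dg : ∀ {m n} (G : Graph m) (H : Graph n) ((φ , _) : G ≅ H) → ∀ v → dg H (Inverse.to φ v) ≡ dg G v
≅-dg G H (φ , pres) v =
  trans (≡-sym (count-permute (adj H (Inverse.to φ v)) φ)) (≡-sym (count-cong (pres v)))

≅-sym : ∀ {m n} (G : Graph m) (H : Graph n) → G ≅ H → H ≅ G
≅-sym G H (φ , pres) = ↔-sym φ , λ i j →
  ≡-sym (trans (pres (from i) (from j)) (cong₂ (adj H) (Inverse.strictlyInverseˡ φ i) (Inverse.strictlyInverseˡ φ j)))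
  where from = Inverse.from φ

realizes : ∀ {n} (U : Graph n) → Unigraph U → (H : Graph n) (σ : Fin n ↔ Fin n) →
           (∀ v → dg H (Inverse.to σ v) ≡ dg U v) → U ≅ H
realizes U uni H σ h = uni H (σ , λ v → trans (degree≡dg H _) (trans (h v) (≡-sym (degree≡dg U v))))

realizes-id : ∀ {n} (U : Graph n) → Unigraph U → (H : Graph n) → (∀ v → dg H v ≡ dg U v) → U ≅ H
realizes-id U uni H h = realizes U uni H (↔-id _) h

relabel : ∀ {m n} → Graph n → (Fin m ↔ Fin n) → Graph m
relabel G π = record
  { adj    = λ i j → adj G (Inverse.to π i) (Inverse.to π j)
  ; sym    = λ i j → sym G (Inverse.to π i) (Inverse.to π j)
  ; irrefl = λ i → irrefl G (Inverse.to π i)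
  }

relabel-dg : ∀ {m n} (G : Graph n) (π : Fin m ↔ Fin n) → ∀ v → dg (relabel G π) v ≡ dg G (Inverse.to π v)
relabel-dg G π v = count-permute (adj G (Inverse.to π v)) π

-- Being a unigraph depends only on the degrees. This allows lemmas on unigraphs to be applied again
-- to a graph that has already been switched.
Unigraph-transport : ∀ {n} (U H : Graph n) → Unigraph U → (∀ v → dg H v ≡ dg U v) → Unigraph H
Unigraph-transport U H uni h K (σ , eq) = ≅-trans (≅-sym U H (realizes-id U uni H h)) UK
  where
  UK : U ≅ K
  UK = uni K (σ , λ i → trans (eq i) (trans (degree≡dg H i) (trans (h i) (≡-sym (degree≡dg U i)))))
  ≅-trans : H ≅ U → U ≅ K → H ≅ K
  ≅-trans (f , p) (g , q) = g ↔-∘ f , λ i j → trans (p i j) (q _ _)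

-- Switches and edge transfers

One : ∀ {n} → Fin n → Fin n → Fin n → Set
One x z u = u ≡ x ⊎ u ≡ z

one : ∀ {n} → Fin n → Fin n → Fin n → Bool
one x z u = (u == x) ∨ (u == z)

one-true : ∀ {n} {x z u : Fin n} → One x z u → one x z u ≡ true
one-true {x = x} (inj₁ refl) rewrite ==-refl x = refl
one-true {x = x} {z} (inj₂ refl) rewrite ==-refl z with z == x
... | true  = refl
... | false = refl

one-sound : ∀ {n} (x z u : Fin n) → one x z u ≡ true → One x z u
one-sound x z u h with u ≟ x | u ≟ z
... | yes p | _     = inj₁ p
... | no _  | yes q = inj₂ q
... | no _  | no _  with () ← h

-- Complementing the adjacencies between {x,z} and {y,w}: a 2-switch on an alternating
-- 4-cycle x y z w, or (when x = z) the transfer of an edge xy to xw.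
module Toggle {n} (G : Graph n) (x y z w : Fin n) (x≢y : x ≢ y) (x≢w : x ≢ w) (z≢y : z ≢ y) (z≢w : z ≢ w) where

  hit : Fin n → Fin n → Bool
  hit u v = (one x z u ∧ one y w v) ∨ (one y w u ∧ one x z v)

  private
    disjoint : ∀ u → One x z u → One y w u → ⊥
    disjoint u (inj₁ refl) (inj₁ q) = x≢y q
    disjoint u (inj₁ refl) (inj₂ q) = x≢w q
    disjoint u (inj₂ refl) (inj₁ q) = z≢y q
    disjoint u (inj₂ refl) (inj₂ q) = z≢w q

    hit-irrefl : ∀ u → hit u u ≡ false
    hit-irrefl u with one x z u in p | one y w u in q
    ... | true  | true  = ⊥-elim (disjoint u (one-sound x z u p) (one-sound y w u q))
    ... | true  | false = refl
    ... | false | true  = refl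
    ... | false | false = refl

    ∧-∨-swap : ∀ a b c d → (a ∧ b) ∨ (c ∧ d) ≡ (d ∧ c) ∨ (b ∧ a)
    ∧-∨-swap true  true  true  true  = refl
    ∧-∨-swap true  true  true  false = refl
    ∧-∨-swap true  true  false true  = refl
    ∧-∨-swap true  true  false false = refl
    ∧-∨-swap true  false true  true  = refl
    ∧-∨-swap true  false true  false = refl
    ∧-∨-swap true  false false true  = refl
    ∧-∨-swap true  false false false = refl
    ∧-∨-swap false true  true  true  = refl
    ∧-∨-swap false true  true  false = refl
    ∧-∨-swap false true  false true  = refl
    ∧-∨-swap false true  false false = refl
    ∧-∨-swap false false true  true  = refl
    ∧-∨-swap false false true  false = refl
    ∧-∨-swap false false false true  = refl
    ∧-∨-swap false false false false = refl

  opaque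
    toggled : Graph n
    toggled = record
      { adj    = λ u v → hit u v xor adj G u v
      ; sym    = λ u v → cong₂ _xor_ (∧-∨-swap (one x z u) (one y w v) (one y w u) (one x z v)) (sym G u v)
      ; irrefl = λ u → cong₂ _xor_ (hit-irrefl u) (irrefl G u)
      }

    on : ∀ {u v} → One x z u → One y w v → adj toggled u v ≡ not (adj G u v)
    on p q rewrite one-true p | one-true q = refl

    view : ∀ u v → adj toggled u v ≡ adj G u v ⊎ (One x z u × One y w v) ⊎ (One y w u × One x z v)
    view u v with one x z u in p | one y w v in q | one y w u in r | one x z v in s
    ... | true  | true  | _     | _     = inj₂ (inj₁ (one-sound x z u p , one-sound y w v q))
    ... | true  | false | true  | true  = inj₂ (inj₂ (one-sound y w u r , one-sound x z v s))
    ... | true  | false | true  | false = inj₁ refl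
    ... | true  | false | false | _     = inj₁ refl
    ... | false | _     | true  | true  = inj₂ (inj₂ (one-sound y w u r , one-sound x z v s))
    ... | false | _     | true  | false = inj₁ refl
    ... | false | _     | false | _     = inj₁ refl

  off : ∀ {u v} → ¬ (One x z u × One y w v) → ¬ (One y w u × One x z v) → adj toggled u v ≡ adj G u v
  off {u} {v} h k with view u v
  ... | inj₁ e        = e
  ... | inj₂ (inj₁ p) = ⊥-elim (h p)
  ... | inj₂ (inj₂ p) = ⊥-elim (k p)

  off-row : ∀ {u} → u ≢ x → u ≢ y → u ≢ z → u ≢ w → ∀ v → adj toggled u v ≡ adj G u v
  off-row ux uy uz uw v = off (λ { (inj₁ p , _) → ux p ; (inj₂ p , _) → uz p })
                              (λ { (inj₁ p , _) → uy p ; (inj₂ p , _) → uw p })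

  off-xz : ∀ {u} → One x z u → ∀ v → v ≢ y → v ≢ w → adj toggled u v ≡ adj G u v
  off-xz p v vy vw = off (λ { (_ , inj₁ q) → vy q ; (_ , inj₂ q) → vw q }) (λ { (r , _) → disjoint _ p r })

  off-yw : ∀ {u} → One y w u → ∀ v → v ≢ x → v ≢ z → adj toggled u v ≡ adj G u v
  off-yw p v vx vz = off (λ { (r , _) → disjoint _ r p }) (λ { (_ , inj₁ q) → vx q ; (_ , inj₂ q) → vz q })

-- The inequalities accompany the nonedges because a vertex is nonadjacent to itself; all other
-- distinctness follows from the adjacencies.
record Alternating {n} (G : Graph n) (x y z w : Fin n) : Set where
  constructor alternating
  field
    xy  : adj G x y ≡ true
    yz  : adj G y z ≡ false
    zw  : adj G z w ≡ true
    wx  : adj G w x ≡ false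
    y≢z : y ≢ z
    w≢x : w ≢ x

module Switch {n} (G : Graph n) {x y z w : Fin n} (alt : Alternating G x y z w) where
  open Alternating alt public

  open Toggle G x y z w (edge-≢ G xy) (w≢x ∘ ≡-sym) (y≢z ∘ ≡-sym) (edge-≢ G zw) public renaming (toggled to switched)

  xy′ : adj switched x y ≡ false
  xy′ = trans (on (inj₁ refl) (inj₁ refl)) (cong not xy)
  yz′ : adj switched y z ≡ true
  yz′ = flip switched (trans (on (inj₂ refl) (inj₁ refl)) (cong not (flip G yz)))
  zw′ : adj switched z w ≡ false
  zw′ = trans (on (inj₂ refl) (inj₂ refl)) (cong not zw)
  wx′ : adj switched w x ≡ true
  wx′ = flip switched (trans (on (inj₁ refl) (inj₂ refl)) (cong not (flip G wx)))

  switched-dg : ∀ v → dg switched v ≡ dg G v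
  switched-dg v with eq? v x | eq? v y | eq? v z | eq? v w
  ... | inj₁ refl | _ | _ | _ = count-exchange w y
        (λ i iw iy → off-xz (inj₁ refl) i iy iw) (flip switched wx′) (flip G wx) xy′ xy
  ... | inj₂ _ | inj₁ refl | _ | _ = count-exchange z x
        (λ i iz ix → off-yw (inj₁ refl) i ix iz) yz′ yz (flip switched xy′) (flip G xy)
  ... | inj₂ _ | inj₂ _ | inj₁ refl | _ = count-exchange y w
        (λ i iy iw → off-xz (inj₂ refl) i iy iw) (flip switched yz′) (flip G yz) zw′ zw
  ... | inj₂ _ | inj₂ _ | inj₂ _ | inj₁ refl = count-exchange x z
        (λ i ix iz → off-yw (inj₂ refl) i ix iz) wx′ wx (flip switched zw′) (flip G zw)
  ... | inj₂ p | inj₂ q | inj₂ r | inj₂ s = count-cong (off-row p q r s)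

opaque
  _≡ⁿ_ : ℕ → ℕ → Bool
  a ≡ⁿ b = does (a ℕ.≟ b)

  ≡ⁿ-sound : ∀ {a b} → (a ≡ⁿ b) ≡ true → a ≡ b
  ≡ⁿ-sound {a} {b} h = ℕ.≡ᵇ⇒≡ a b (subst T (≡-sym h) _)

  ≡ⁿ-true : ∀ {a b} → a ≡ b → (a ≡ⁿ b) ≡ true
  ≡ⁿ-true {a} {b} p = dec-true (a ℕ.≟ b) p

  ≡ⁿ-false : ∀ {a b} → a ≢ b → (a ≡ⁿ b) ≡ false
  ≡ⁿ-false {a} {b} p = dec-false (a ℕ.≟ b) p

typed : ∀ {n} → Graph n → (Fin n → ℕ) → ℕ → ℕ → Fin n → Fin n → Bool
typed G d i j u v = (d u ≡ⁿ i) ∧ ((d v ≡ⁿ j) ∧ adj G u v)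

typed-true : ∀ {n} (G : Graph n) (d : Fin n → ℕ) i j u v → typed G d i j u v ≡ true →
             d u ≡ i × d v ≡ j × adj G u v ≡ true
typed-true G d i j u v h with p , h′ ← ∧-true {d u ≡ⁿ i} h with q , r ← ∧-true {d v ≡ⁿ j} h′ =
  ≡ⁿ-sound p , ≡ⁿ-sound q , r

typed-intro : ∀ {n} (G : Graph n) (d : Fin n → ℕ) {i j} u v → d u ≡ i → d v ≡ j → adj G u v ≡ true →
              typed G d i j u v ≡ true
typed-intro G d u v p q r = ∧-intro (≡ⁿ-true p) (∧-intro (≡ⁿ-true q) r)

-- Types are measured by `dg U` on both sides. The degree functions agree, so the isomorphism,
-- preserving degrees, preserves types too.
typed-count : ∀ {n} (U : Graph n) → Unigraph U → (H : Graph n) → (∀ v → dg H v ≡ dg U v) →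
              ∀ i j → count₂ (typed U (dg U) i j) ≡ count₂ (typed H (dg U) i j)
typed-count U uni H h i j = count₂-permute (proj₁ φ) _ _ λ u v →
  cong₂ _∧_ (cong (_≡ⁿ i) (pres u)) (cong₂ _∧_ (cong (_≡ⁿ j) (pres v)) (proj₂ φ u v))
  where
  φ : U ≅ H
  φ = realizes-id U uni H h
  pres : ∀ u → dg U u ≡ dg U (Inverse.to (proj₁ φ) u)
  pres u = trans (≡-sym (≅-dg U H φ u)) (h _)

-- Otherwise the switch destroys an edge of degree type {dg x, dg y} and creates none.
alternating-degrees : ∀ {n} (U : Graph n) → Unigraph U → ∀ {x y z w} → Alternating U x y z w →
                      dg U x ≡ dg U z ⊎ dg U y ≡ dg U w
alternating-degrees U uni {x} {y} {z} {w} alt with dg U x ℕ.≟ dg U z | dg U y ℕ.≟ dg U w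
... | yes p | _     = inj₁ p
... | no _  | yes q = inj₂ q
... | no x≁z | no y≁w = ⊥-elim (<-irrefl (≡-sym (typed-count U uni switched switched-dg (d x) (d y)))
        (count₂-strict _ _ sub x y notin isin))
  where
  open Switch U alt
  d = dg U
  isin : typed U d (d x) (d y) x y ≡ true
  isin = typed-intro U d x y refl refl xy
  notin : typed switched d (d x) (d y) x y ≡ false
  notin = ¬true⇒false (λ h → true≢false (proj₂ (proj₂ (typed-true switched d (d x) (d y) x y h))) xy′)
  sub′ : ∀ u v → d u ≡ d x → d v ≡ d y → adj switched u v ≡ true → adj U u v ≡ true
  sub′ u v du dv e with view u v
  ... | inj₁ same = trans (≡-sym same) e
  ... | inj₂ (inj₁ (inj₁ refl , inj₁ refl)) = xy
  ... | inj₂ (inj₁ (inj₁ refl , inj₂ refl)) = ⊥-elim (y≁w (≡-sym dv))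
  ... | inj₂ (inj₁ (inj₂ refl , _)) = ⊥-elim (x≁z (≡-sym du))
  ... | inj₂ (inj₂ (inj₁ refl , inj₁ refl)) = flip U xy
  ... | inj₂ (inj₂ (inj₁ refl , inj₂ refl)) = ⊥-elim (x≁z (trans (≡-sym du) (≡-sym dv)))
  ... | inj₂ (inj₂ (inj₂ refl , inj₁ refl)) = ⊥-elim (y≁w (trans (≡-sym dv) (≡-sym du)))
  ... | inj₂ (inj₂ (inj₂ refl , inj₂ refl)) = flip U zw
  sub : ∀ u v → typed switched d (d x) (d y) u v ≡ true → typed U d (d x) (d y) u v ≡ true
  sub u v h with du , dv , e ← typed-true switched d (d x) (d y) u v h = typed-intro U d u v du dv (sub′ u v du dv e)

within : ∀ {n} → Graph n → (Fin n → Bool) → Fin n → ℕ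
within G K v = count (λ u → K u ∧ adj G v u)

-- Switching moves one edge inside the degree class from x to z, so the two inner degrees must be swapped.
class-degrees : ∀ {n} (U : Graph n) → Unigraph U → ∀ p {x y z w} → Alternating U x y z w →
                dg U x ≡ p → dg U y ≡ p → dg U z ≡ p → dg U w ≢ p →
                let K = λ u → dg U u ≡ⁿ p in within U K x ≡ suc (within U K z)
class-degrees {n} U uni p {x} {y} {z} {w} alt dx dy dz dw with within U K x ℕ.≟ suc (within U K z)
  where
  K : Fin n → Bool
  K u = dg U u ≡ⁿ p
... | yes e = e
... | no ¬e = ⊥-elim (noProper (proj₁ φ) P P′ eq sub x
        (∧-intro (≡ⁿ-true dx) (≡ⁿ-true refl)) (¬true⇒false λ h → 1+n≢n (trans (≡-sym kx) (≡-sym (≡ⁿ-sound (proj₂ (∧-true {K x} h)))))))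
  where
  K : Fin n → Bool
  K u = dg U u ≡ⁿ p
  open Switch U alt
  S = switched
  φ : U ≅ S
  φ = realizes-id U uni S switched-dg
  f = Inverse.to (proj₁ φ)
  Kf : ∀ u → K u ≡ K (f u)
  Kf u = cong (_≡ⁿ p) (trans (≡-sym (≅-dg U S φ u)) (switched-dg _))
  -- The switch removes `x` from this set, and only `z` could enter it. If `z` does not, the set
  -- shrinks properly although the isomorphism carries `P` to `P′`.
  P P′ : Fin n → Bool
  P  v = K v ∧ (within U K v ≡ⁿ within U K x)
  P′ v = K v ∧ (within S K v ≡ⁿ within U K x)
  eq : ∀ v → P v ≡ P′ (f v)
  eq v = cong₂ _∧_ (Kf v) (cong (_≡ⁿ within U K x)
    (trans (count-cong (λ u → cong₂ _∧_ (Kf u) (proj₂ φ v u)))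
           (count-permute (λ u → K u ∧ adj S (f v) u) (proj₁ φ))))
  inK : ∀ {u b} {A : Bool} → dg U u ≡ p → A ≡ b → K u ∧ A ≡ b
  inK du refl rewrite ≡ⁿ-true du = refl
  kx : within U K x ≡ suc (within S K x)
  kx = count-remove y agree (inK dy xy) (inK dy xy′)
    where
    agree : ∀ i → i ≢ y → K i ∧ adj U x i ≡ K i ∧ adj S x i
    agree i iy with eq? i w
    ... | inj₁ refl rewrite ≡ⁿ-false dw = refl
    ... | inj₂ iw = cong (K i ∧_) (≡-sym (off-xz (inj₁ refl) i iy iw))
  kz : within S K z ≡ suc (within U K z)
  kz = count-remove y agree (inK dy (flip S yz′)) (inK dy (flip U yz))
    where
    agree : ∀ i → i ≢ y → K i ∧ adj S z i ≡ K i ∧ adj U z i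
    agree i iy with eq? i w
    ... | inj₁ refl rewrite ≡ⁿ-false dw = refl
    ... | inj₂ iw = cong (K i ∧_) (off-xz (inj₂ refl) i iy iw)
  same : ∀ v → v ≢ x → v ≢ z → within S K v ≡ within U K v
  same v vx vz with eq? v y | eq? v w
  ... | inj₁ refl | _ = count-exchange z x (λ i iz ix → cong (K i ∧_) (off-yw (inj₁ refl) i ix iz))
          (inK dz yz′) (inK dz yz) (inK dx (flip S xy′)) (inK dx (flip U xy))
  ... | inj₂ _ | inj₁ refl = count-exchange x z (λ i ix iz → cong (K i ∧_) (off-yw (inj₂ refl) i ix iz))
          (inK dx wx′) (inK dx wx) (inK dz (flip S zw′)) (inK dz (flip U zw))
  ... | inj₂ vy | inj₂ vw = count-cong (λ i → cong (K i ∧_) (off-row vx vy vz vw i))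
  sub : ∀ v → P′ v ≡ true → P v ≡ true
  sub v h with k , e ← ∧-true {K v} h with eq? v x | eq? v z
  ... | inj₁ refl | _ = ∧-intro k (≡ⁿ-true refl)
  ... | inj₂ _ | inj₁ refl = ⊥-elim (¬e (trans (≡-sym (≡ⁿ-sound e)) kz))
  ... | inj₂ vx | inj₂ vz = ∧-intro k (≡ⁿ-true (trans (≡-sym (same v vx vz)) (≡ⁿ-sound e)))

transpose-left : ∀ {n} (i j : Fin n) → Inverse.to (transpose i j) i ≡ j
transpose-left i j rewrite ==-refl i = refl

transpose-right : ∀ {n} (i j : Fin n) → Inverse.to (transpose i j) j ≡ i
transpose-right i j with j ≟ i
... | yes p = p
... | no _ rewrite ==-refl j = refl

transpose-other : ∀ {n} {i j k : Fin n} → k ≢ i → k ≢ j → Inverse.to (transpose i j) k ≡ k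
transpose-other ki kj rewrite ==-≢ ki | ==-≢ kj = refl

inverse-injective : ∀ {m n} (π : Fin m ↔ Fin n) {i j} → Inverse.to π i ≡ Inverse.to π j → i ≡ j
inverse-injective π {i} {j} e =
  trans (≡-sym (Inverse.strictlyInverseʳ π i)) (trans (cong (Inverse.from π) e) (Inverse.strictlyInverseʳ π j))

module _ {n} (U : Graph n) (uni : Unigraph U) {a b c : Fin n}
         (ab : adj U a b ≡ true) (bc : adj U b c ≡ true) (ac : adj U a c ≡ false)
         (db : dg U b ≡ suc (dg U c)) (a≁c : dg U a ≢ dg U c) where

  private
    d = dg U
    b≁c : d b ≢ d c
    b≁c e = 1+n≢n (trans (≡-sym db) e)
    a≢c : a ≢ c
    a≢c e = a≁c (cong d e)

    backward : ∀ {y} → d y ≡ d c → adj U y c ≡ true → adj U y b ≡ true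
    backward {y} dy yc with adj U y b in yb
    ... | true  = refl
    ... | false with alternating-degrees U uni (alternating (flip U yc) yb (flip U ab) ac (λ { refl → b≁c dy }) a≢c)
    ...   | inj₁ e = ⊥-elim (b≁c (≡-sym e))
    ...   | inj₂ e = ⊥-elim (a≁c (trans (≡-sym e) dy))

    open Toggle U a b a c (edge-≢ U ab) a≢c (edge-≢ U ab) a≢c

    ab′ : adj toggled a b ≡ false
    ab′ = trans (on (inj₁ refl) (inj₁ refl)) (cong not ab)
    ac′ : adj toggled a c ≡ true
    ac′ = trans (on (inj₁ refl) (inj₂ refl)) (cong not ac)

    dg-b : suc (dg toggled b) ≡ d b
    dg-b = ≡-sym (count-remove a (λ i ia → ≡-sym (off-yw (inj₁ refl) i ia ia)) (flip U ab) (flip toggled ab′))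
    dg-c : dg toggled c ≡ suc (d c)
    dg-c = count-remove a (λ i ia → off-yw (inj₂ refl) i ia ia) (flip toggled ac′) (flip U ac)
    dg-other : ∀ {v} → v ≢ b → v ≢ c → dg toggled v ≡ d v
    dg-other {v} vb vc with eq? v a
    ... | inj₁ refl = count-exchange c b (λ i ic ib → off-xz (inj₁ refl) i ib ic) ac′ ac ab′ ab
    ... | inj₂ va = count-cong (off-row va vb va vc)

    -- Renaming undoes the exchange of degrees: `R` has exactly the degrees of `U`, and towards the
    -- other vertices of its degree `c` behaves in `R` as `b` does in `U`.
    τ = transpose b c
    R = relabel toggled τ

    R-dg : ∀ v → dg R v ≡ d v
    R-dg v with eq? v b | eq? v c
    ... | inj₁ refl | _ = trans (relabel-dg toggled τ b) (trans (cong (dg toggled) (transpose-left b c)) (trans dg-c (≡-sym db)))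
    ... | inj₂ _ | inj₁ refl = trans (relabel-dg toggled τ c) (trans (cong (dg toggled) (transpose-right b c))
                                 (suc-injective (trans dg-b db)))
    ... | inj₂ vb | inj₂ vc = trans (relabel-dg toggled τ v) (trans (cong (dg toggled) (transpose-other vb vc)) (dg-other vb vc))

    ≢b : ∀ {u} → d u ≡ d c → u ≢ b
    ≢b e refl = b≁c e
    ≢a : ∀ {u} → d u ≡ d c → u ≢ a
    ≢a e refl = a≁c e

    R-row : ∀ {v} → d v ≡ d c → v ≢ c → adj R c v ≡ adj U b v
    R-row {v} dv vc = trans (cong₂ (adj toggled) (transpose-right b c) (transpose-other (≢b dv) vc))
                            (off-yw (inj₁ refl) v (≢a dv) (≢a dv))

    sub : ∀ u v → d u ≡ d c → d v ≡ d c → adj U u v ≡ true → adj R u v ≡ true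
    sub u v du dv e with eq? u c | eq? v c
    ... | inj₁ refl | inj₁ refl = ⊥-elim (edge-≢ U e refl)
    ... | inj₁ refl | inj₂ vc = trans (R-row dv vc) (flip U (backward dv (flip U e)))
    ... | inj₂ uc | inj₁ refl = trans (sym R u v) (trans (R-row du uc) (flip U (backward du e)))
    ... | inj₂ uc | inj₂ vc = trans (cong₂ (adj toggled) (transpose-other (≢b du) uc) (transpose-other (≢b dv) vc))
                                (trans (off-row (≢a du) (≢b du) (≢a du) uc v) e)

    forward : ∀ {y} → d y ≡ d c → y ≢ c → adj U y b ≡ true → adj U y c ≡ true
    forward {y} dy y≢c yb with adj U y c in yc
    ... | true  = refl
    ... | false = ⊥-elim (<-irrefl (typed-count U uni R R-dg (d c) (d c))
          (count₂-strict _ _ sub′ c y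
            (¬true⇒false λ h → true≢false (proj₂ (proj₂ (typed-true U d (d c) (d c) c y h))) (flip U yc))
            (typed-intro R d c y refl dy (trans (R-row dy y≢c) (flip U yb)))))
      where
      sub′ : ∀ u v → typed U d (d c) (d c) u v ≡ true → typed R d (d c) (d c) u v ≡ true
      sub′ u v h with du , dv , e ← typed-true U d (d c) (d c) u v h = typed-intro R d u v du dv (sub u v du dv e)

  -- Moving the edge ab to ac exchanges the degrees of b and c; the number of edges
  -- between vertices of degree dg c must not change.
  same-low-neighbours : ∀ {y} → d y ≡ d c → y ≢ c → adj U y b ≡ adj U y c
  same-low-neighbours dy y≢c = bool-ext (forward dy y≢c) (backward dy)

-- Complements and degree classes

opaque
  -- The diagonal test is written `v == u` so that the row of `u` is literally `not ∘ adj G u − u`,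
  -- to which the counting lemmas apply.
  co : ∀ {n} → Graph n → Graph n
  co G = record
    { adj    = λ u v → not (adj G u v) ∧ not (v == u)
    ; sym    = λ u v → cong₂ _∧_ (cong not (sym G u v)) (cong not (==-sym v u))
    ; irrefl = λ u → −-hit (not ∘ adj G u) u
    }
    where
    ==-sym : ∀ {n} (i j : Fin n) → (i == j) ≡ (j == i)
    ==-sym i j with eq? i j
    ... | inj₁ refl = refl
    ... | inj₂ ij = trans (==-≢ ij) (≡-sym (==-≢ (ij ∘ ≡-sym)))

  co-adj : ∀ {n} (G : Graph n) {u v b} → u ≢ v → adj G u v ≡ b → adj (co G) u v ≡ not b
  co-adj G {u} {v} uv refl = −-miss (not ∘ adj G u) (uv ∘ ≡-sym)

  co-dg : ∀ {n} (G : Graph n) v → dg G v + suc (dg (co G) v) ≡ n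
  co-dg G v = trans (cong (dg G v +_) (≡-sym (count-− (not ∘ adj G v) (cong not (irrefl G v)))))
                    (count-complement (adj G v))

-- If `H` has the degrees of the complement, then `co H` has those of `U`; complementing the
-- resulting isomorphism gives the one sought.
co-unigraph : ∀ {n} (U : Graph n) → Unigraph U → Unigraph (co U)
co-unigraph U uni H (σ , h) = φ , pres
  where
  hdg : ∀ v → dg H (Inverse.to σ v) ≡ dg (co U) v
  hdg v = trans (≡-sym (degree≡dg H _)) (trans (h v) (degree≡dg (co U) v))
  iso : U ≅ co H
  iso = realizes U uni (co H) σ λ v → suc-injective (+-cancelˡ-≡ (dg (co U) v) _ _
    (trans (cong (_+ _) (≡-sym (hdg v))) (trans (co-dg H (Inverse.to σ v))
      (trans (≡-sym (co-dg U v)) (trans (+-suc _ _) (trans (cong suc (+-comm (dg U v) _)) (≡-sym (+-suc _ _))))))))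
  φ = proj₁ iso
  pres : ∀ i j → adj (co U) i j ≡ adj H (Inverse.to φ i) (Inverse.to φ j)
  pres i j with eq? i j
  ... | inj₁ refl = trans (irrefl (co U) i) (≡-sym (irrefl H _))
  ... | inj₂ ij = trans (co-adj U ij refl) (trans (cong not (trans (proj₂ iso i j) (co-adj H (ij ∘ inverse-injective φ) refl)))
                    (not-involutive _))

co-dg-≡ : ∀ {n} (G : Graph n) {u v} → dg G u ≡ dg G v → dg (co G) u ≡ dg (co G) v
co-dg-≡ G {u} {v} e = suc-injective (+-cancelˡ-≡ (dg G u) _ _
  (trans (co-dg G u) (trans (≡-sym (co-dg G v)) (cong (_+ suc (dg (co G) v)) (≡-sym e)))))

co-dg-suc : ∀ {n} (G : Graph n) {u v} → dg G u ≡ suc (dg G v) → dg (co G) v ≡ suc (dg (co G) u)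
co-dg-suc G {u} {v} e = suc-injective (+-cancelˡ-≡ (dg G v) _ _
  (trans (co-dg G v) (trans (≡-sym (co-dg G u)) (trans (cong (_+ suc (dg (co G) u)) e) (≡-sym (+-suc _ _))))))

co-dg-< : ∀ {n} (G : Graph n) {u v} → dg G u < dg G v → dg (co G) v < dg (co G) u
co-dg-< G {u} {v} lt = ℕ.≰⇒> λ le → <-irrefl (trans (co-dg G u) (≡-sym (co-dg G v))) (ℕ.+-mono-<-≤ lt (s≤s le))

injective⇒surjective : ∀ {n} (f : Fin n → Fin n) → (∀ {i j} → f i ≡ f j → i ≡ j) → ∀ y → ∃ λ x → f x ≡ y
injective⇒surjective {suc n} f inj y with any? (λ x → f x ≟ y)
... | yes r = r
... | no ¬r = ⊥-elim (1+n≰n (injective⇒≤ {f = λ x → punchOut (λ e → ¬r (x , ≡-sym e))}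
                (λ e → inj (punchOut-injective (λ e → ¬r (_ , ≡-sym e)) (λ e → ¬r (_ , ≡-sym e)) e))))

injective⇒↔ : ∀ {n} (f : Fin n → Fin n) → (∀ {i j} → f i ≡ f j → i ≡ j) → Fin n ↔ Fin n
injective⇒↔ f inj = mk↔ₛ′ f (proj₁ ∘ surj) (proj₂ ∘ surj) (λ x → inj (proj₂ (surj (f x))))
  where surj = injective⇒surjective f inj

-- Presents a vertex set as `Fin size`, so that a degree class becomes a graph of its own;
-- `count-at` identifies degrees there with inner degrees.
record Enumeration {n} (K : Fin n → Bool) : Set where
  field
    size      : ℕ
    at        : Fin size → Fin n
    at-inj    : ∀ {i j} → at i ≡ at j → i ≡ j
    at-in     : ∀ i → K (at i) ≡ true
    index     : ∀ u → K u ≡ true → ∃ λ i → at i ≡ u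
    count-at  : ∀ P → count (λ u → K u ∧ P u) ≡ count (P ∘ at)

  -- A missed vertex can be prepended to the enumeration. The strict inequality is what makes the
  -- recursion through degree classes terminate.
  size<n : ∀ {v} → K v ≡ false → size < n
  size<n {v} h = injective⇒≤ {f = f} f-inj
    where
    f : Fin (suc size) → Fin n
    f zero    = v
    f (suc i) = at i
    f-inj : ∀ {i j} → f i ≡ f j → i ≡ j
    f-inj {zero}  {zero}  _ = refl
    f-inj {zero}  {suc j} e = ⊥-elim (true≢false (at-in j) (trans (cong K (≡-sym e)) h))
    f-inj {suc i} {zero}  e = ⊥-elim (true≢false (at-in i) (trans (cong K e) h))
    f-inj {suc i} {suc j} e = cong suc (at-inj e)

opaque
  unfolding count

  enumerate : ∀ {n} (K : Fin n → Bool) → Enumeration K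
  enumerate {zero} K = record
    { size = 0 ; at = λ () ; at-inj = λ { {()} } ; at-in = λ () ; index = λ () ; count-at = λ _ → refl }
  enumerate {suc n} K with enumerate (K ∘ suc) | K zero in k0
  ... | rec | false = record
    { size = size ; at = suc ∘ at ; at-inj = λ { e → at-inj (Fin-suc-injective e) } ; at-in = at-in
    ; index = λ { zero h → ⊥-elim (true≢false h k0)
                ; (suc u) h → proj₁ (index u h) , cong suc (proj₂ (index u h)) }
    ; count-at = λ P → cong₂ _+_ (cong (λ b → bit (b ∧ P zero)) k0) (count-at (P ∘ suc)) }
    where
    open Enumeration rec
  ... | rec | true = record
    { size = suc size ; at = at⁺ ; at-inj = at⁺-inj
    ; at-in = λ { zero → k0 ; (suc i) → at-in i }
    ; index = λ { zero h → zero , refl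
                ; (suc u) h → suc (proj₁ (index u h)) , cong suc (proj₂ (index u h)) }
    ; count-at = λ P → cong₂ _+_ (cong (λ b → bit (b ∧ P zero)) k0) (count-at (P ∘ suc)) }
    where
    open Enumeration rec
    at⁺ : Fin (suc size) → Fin (suc n)
    at⁺ zero    = zero
    at⁺ (suc i) = suc (at i)
    at⁺-inj : ∀ {i j} → at⁺ i ≡ at⁺ j → i ≡ j
    at⁺-inj {zero}  {zero}  _ = refl
    at⁺-inj {suc i} {suc j} e = cong suc (at-inj (Fin-suc-injective e))

induce : ∀ {m n} → Graph n → (Fin m → Fin n) → Graph m
adj    (induce G f) i j = adj G (f i) (f j)
sym    (induce G f) i j = sym G (f i) (f j)
irrefl (induce G f) i   = irrefl G (f i)

module _ {n} (U : Graph n) {K : Fin n → Bool} (en : Enumeration K) (R : Graph (Enumeration.size en)) where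
  open Enumeration en

  private
    Found : Fin n → Set
    Found u = ∃ λ i → at i ≡ u

    choose : ∀ {u v} → Dec (Found u) → Dec (Found v) → Bool → Bool
    choose (yes (i , _)) (yes (j , _)) _ = adj R i j
    choose (yes _)       (no _)        b = b
    choose (no _)        _             b = b

    choose-sym : ∀ {u v} (p : Dec (Found u)) (q : Dec (Found v)) {b c} → b ≡ c → choose p q b ≡ choose q p c
    choose-sym (yes (i , _)) (yes (j , _)) e = sym R i j
    choose-sym (yes _) (no _)  e = e
    choose-sym (no _)  (yes _) e = e
    choose-sym (no _)  (no _)  e = e

    choose-irrefl : ∀ {u} (p : Dec (Found u)) {b} → b ≡ false → choose p p b ≡ false
    choose-irrefl (yes (i , _)) e = irrefl R i
    choose-irrefl (no _) e = e

    find : ∀ u → Dec (Found u)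
    find u = any? (λ i → at i ≟ u)

  opaque
    -- `U` with its edges inside `K` replaced by those of `R`; every pair leaving `K` keeps its
    -- adjacency.
    graft : Graph n
    graft = record
      { adj    = λ u v → choose (find u) (find v) (adj U u v)
      ; sym    = λ u v → choose-sym (find u) (find v) (sym U u v)
      ; irrefl = λ u → choose-irrefl (find u) (irrefl U u)
      }

    graft-in : ∀ i j → adj graft (at i) (at j) ≡ adj R i j
    graft-in i j with find (at i) | find (at j)
    ... | yes (i′ , p) | yes (j′ , q) = cong₂ (adj R) (at-inj p) (at-inj q)
    ... | no ¬p | _     = ⊥-elim (¬p (i , refl))
    ... | yes _ | no ¬q = ⊥-elim (¬q (j , refl))

    graft-out : ∀ {u} v → K u ≡ false → adj graft u v ≡ adj U u v
    graft-out {u} v h with find u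
    ... | yes (i , refl) = ⊥-elim (true≢false (at-in i) h)
    ... | no _ = refl

  graft-dg : (∀ i → dg R i ≡ dg (induce U at) i) → ∀ v → dg graft v ≡ dg U v
  graft-dg h v with K v in kv
  ... | false = count-cong (λ u → graft-out u kv)
  ... | true with i , refl ← index v kv =
    trans (count-split K (adj graft (at i)))
      (trans (cong₂ _+_ inside (count-cong outside)) (≡-sym (count-split K (adj U (at i)))))
    where
    inside : count (λ u → K u ∧ adj graft (at i) u) ≡ count (λ u → K u ∧ adj U (at i) u)
    inside = trans (count-at _) (trans (count-cong (graft-in i)) (trans (h i) (≡-sym (count-at _))))
    outside : ∀ u → not (K u) ∧ adj graft (at i) u ≡ not (K u) ∧ adj U (at i) u
    outside u with K u in ku
    ... | true  = refl
    ... | false = flip graft (trans (graft-out (at i) ku) (sym U u (at i)))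

within-dg : ∀ {n} (U : Graph n) {K : Fin n → Bool} (en : Enumeration K) → let open Enumeration en in
            ∀ i → dg (induce U at) i ≡ within U K (at i)
within-dg U en i = ≡-sym (Enumeration.count-at en (adj U (Enumeration.at en i)))

-- Grafting a second realisation of the class into `U` changes no degree, so the result is
-- isomorphic to `U`; the isomorphism maps the class to itself and restricts to the one required.
class-unigraph : ∀ {n} (U : Graph n) → Unigraph U → ∀ p (en : Enumeration (λ u → dg U u ≡ⁿ p)) →
                 Unigraph (induce U (Enumeration.at en))
class-unigraph U uni p en R (σ , h) = σ ↔-∘ injective⇒↔ f f-inj , pres
  where
  open Enumeration en
  R′ = relabel R σ
  hdg : ∀ i → dg R′ i ≡ dg (induce U at) i
  hdg i = trans (relabel-dg R σ i) (trans (≡-sym (degree≡dg R _)) (trans (h i) (degree≡dg (induce U at) i)))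
  G = graft U en R′
  Gdg = graft-dg U en R′ hdg
  φ : U ≅ G
  φ = realizes-id U uni G Gdg
  to = Inverse.to (proj₁ φ)
  stays : ∀ i → (dg U (to (at i)) ≡ⁿ p) ≡ true
  stays i = ≡ⁿ-true (trans (≡-sym (Gdg _)) (trans (≅-dg U G φ (at i)) (≡ⁿ-sound (at-in i))))
  f : Fin size → Fin size
  f i = proj₁ (index (to (at i)) (stays i))
  f-at : ∀ i → at (f i) ≡ to (at i)
  f-at i = proj₂ (index (to (at i)) (stays i))
  f-inj : ∀ {i j} → f i ≡ f j → i ≡ j
  f-inj {i} {j} e = at-inj (inverse-injective (proj₁ φ) (trans (≡-sym (f-at i)) (trans (cong at e) (f-at j))))
  pres : ∀ i j → adj U (at i) (at j) ≡ adj R′ (f i) (f j)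
  pres i j = trans (proj₂ φ (at i) (at j)) (trans (≡-sym (cong₂ (adj G) (f-at i) (f-at j))) (graft-in U en R′ (f i) (f j)))

-- Induced paths in a unigraph

record Path {n} (G : Graph n) (a b c d : Fin n) : Set where
  constructor path
  field
    ab : adj G a b ≡ true
    bc : adj G b c ≡ true
    cd : adj G c d ≡ true
    ac : adj G a c ≡ false
    bd : adj G b d ≡ false
    ad : adj G a d ≡ false

  a≢b : a ≢ b
  a≢b = edge-≢ G ab
  b≢c : b ≢ c
  b≢c = edge-≢ G bc
  c≢d : c ≢ d
  c≢d = edge-≢ G cd
  a≢c : a ≢ c
  a≢c = row-≢ G cd ad ∘ ≡-sym
  b≢d : b ≢ d
  b≢d = col-≢ G ab ad
  a≢d : a ≢ d
  a≢d = row-≢ G ab (flip G bd)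

  -- Switching on this cycle turns the path abcd into acbd.
  alt : Alternating G b a c d
  alt = alternating (flip G ab) ac cd (flip G bd) a≢c (b≢d ∘ ≡-sym)

reverse : ∀ {n} {G : Graph n} {a b c d} → Path G a b c d → Path G d c b a
reverse {G = G} (path ab bc cd ac bd ad) =
  path (flip G cd) (flip G bc) (flip G ab) (flip G bd) (flip G ac) (flip G ad)

co-path : ∀ {n} {G : Graph n} {a b c d} → Path G a b c d → Path (co G) b d a c
co-path {G = G} P = path (co-adj G b≢d bd) (co-adj G (a≢d ∘ ≡-sym) (flip G ad)) (co-adj G a≢c ac)
                         (co-adj G (a≢b ∘ ≡-sym) (flip G ab)) (co-adj G (c≢d ∘ ≡-sym) (flip G cd)) (co-adj G b≢c bc)
  where open Path P

infixl 6 _∖_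
_∖_ : ∀ {n} → (Fin n → Bool) → (Fin n → Bool) → (Fin n → Bool)
(P ∖ Q) i = not (Q i) ∧ P i

∖-true : ∀ {n} {P Q : Fin n → Bool} {i} → (P ∖ Q) i ≡ true → P i ≡ true × Q i ≡ false
∖-true {Q = Q} {i} h with Q i
... | false = h , refl

∖-intro : ∀ {n} {P Q : Fin n → Bool} {i} → P i ≡ true → Q i ≡ false → (P ∖ Q) i ≡ true
∖-intro p q rewrite q = p

∖-< : ∀ {n} (P Q : Fin n → Bool) → count Q < count P → count (Q ∖ P) < count (P ∖ Q)
∖-< P Q lt = +-cancelˡ-< (count (λ i → P i ∧ Q i)) _ _
  (subst₂ _<_ (count-split P Q)
    (trans (count-split Q P) (cong (_+ count (P ∖ Q)) (count-cong (λ i → ∧-comm (Q i) (P i))))) lt)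

module _ {n} (U : Graph n) (uni : Unigraph U) where
  private d = dg U

  -- Four applications of `alternating-degrees`. The cycle of the path itself keeps the degrees of
  -- `a` and `c`, and of `b` and `e`, apart; the cycle a, u, b, c gives `u` the degree of `c`; the
  -- last two exclude that `u` misses `c` or meets `e`.
  private-neighbours : ∀ {a b c e} → Path U a b c e → d b < d a → d c < d e →
                       ∀ u → (adj U a ∖ adj U b) u ≡ true → (adj U c ∖ adj U e) u ≡ true
  private-neighbours {a} {b} {c} {e} P b<a c<e u h
    with ua , ub ← ∖-true {P = adj U a} {adj U b} {u} h with eq? u b
  ... | inj₁ refl = ∖-intro {P = adj U c} {adj U e} {b} (flip U bc) (flip U bd)
    where open Path P
  ... | inj₂ u≢b = ∖-intro {P = adj U c} {adj U e} {u} uc ue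
    where
    open Path P
    differ : d a ≢ d c × d b ≢ d e
    differ with alternating-degrees U uni alt
    ... | inj₁ b=c = (λ a=c → <⇒≢ b<a (trans b=c (≡-sym a=c))) , (λ b=e → <⇒≢ c<e (trans (≡-sym b=c) b=e))
    ... | inj₂ a=e = (λ a=c → <⇒≢ c<e (trans (≡-sym a=c) a=e)) , (λ b=e → <⇒≢ b<a (trans b=e (≡-sym a=e)))
    du : d u ≡ d c
    du with alternating-degrees U uni (alternating ua (flip U ub) bc (flip U ac) u≢b (a≢c ∘ ≡-sym))
    ... | inj₁ a=b = ⊥-elim (<⇒≢ b<a (≡-sym a=b))
    ... | inj₂ r   = r
    uc : adj U c u ≡ true
    uc with adj U c u in eq
    ... | true  = refl
    ... | false with alternating-degrees U uni (alternating ua (flip U eq) cd (flip U ad) (col-≢ U ua ac) (a≢d ∘ ≡-sym))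
    ...   | inj₁ a=c = ⊥-elim (proj₁ differ a=c)
    ...   | inj₂ u=e = ⊥-elim (<⇒≢ c<e (trans (≡-sym du) u=e))
    ue : adj U e u ≡ false
    ue with adj U e u in eq
    ... | false = refl
    ... | true with alternating-degrees U uni (alternating eq (flip U ub) (flip U ab) ad u≢b a≢d)
    ...   | inj₁ e=b = ⊥-elim (proj₂ differ (≡-sym e=b))
    ...   | inj₂ u=a = ⊥-elim (proj₁ differ (trans (≡-sym u=a) du))

  -- As `a` exceeds `b` in degree, it has more private neighbours against `b` than `b` has against
  -- it; likewise for `e` and `c`. The inclusions for the path and its reverse close these
  -- inequalities into a strict cycle.
  no-double-descent : ∀ {a b c e} → Path U a b c e → d b < d a → d c < d e → ⊥
  no-double-descent {a} {b} {c} {e} P b<a c<e = <-irrefl refl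
    (<-≤-trans (∖-< (adj U a) (adj U b) b<a)
      (ℕ.≤-trans (count-mono (private-neighbours P b<a c<e))
        (ℕ.<⇒≤ (<-≤-trans (∖-< (adj U e) (adj U c) c<e)
          (count-mono (private-neighbours (reverse P) c<e b<a))))))

-- Apart from `c` and `e` themselves, `e` has more neighbours than `c`, and `b` already is a
-- neighbour of `c` only; hence two vertices, not one, are neighbours of `e` only.
two-extra : ∀ {n} (U : Graph n) {b c e} → b ≢ e → adj U b c ≡ true → adj U b e ≡ false → adj U c e ≡ true → dg U c < dg U e →
            ∃₂ λ f g → f ≢ g × (adj U e f ≡ true × adj U c f ≡ false × f ≢ c) × (adj U e g ≡ true × adj U c g ≡ false × g ≢ c)
two-extra U {b} {c} {e} b≢e bc be ce c<e = f , g , g≢f ∘ ≡-sym , (proj₁ ef , fc , proj₂ ef) , (proj₁ eg , gc , proj₂ eg)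
  where
  P₁ = adj U e − c
  Q₁ = adj U c − e
  lt₁ : count Q₁ < count P₁
  lt₁ = s≤s⁻¹ (subst₂ _<_ (count-− (adj U c) ce) (count-− (adj U e) (flip U ce)) c<e)
  pick₁ = count-pick P₁ Q₁ lt₁
  f = proj₁ pick₁
  ef = −-true (adj U e) (proj₁ (proj₂ pick₁))
  fc : adj U c f ≡ false
  fc = trans (≡-sym (−-miss (adj U c) (edge-≢ U (proj₁ ef) ∘ ≡-sym))) (proj₂ (proj₂ pick₁))
  b∈Q₁ : Q₁ b ≡ true
  b∈Q₁ = trans (−-miss (adj U c) b≢e) (flip U bc)
  pick₂ = count-pick (P₁ − f) (Q₁ − b)
    (s≤s⁻¹ (subst₂ _<_ (count-− Q₁ b∈Q₁) (count-− P₁ (proj₁ (proj₂ pick₁))) lt₁))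
  g = proj₁ pick₂
  P₁g = −-true P₁ (proj₁ (proj₂ pick₂))
  g≢f = proj₂ P₁g
  eg = −-true (adj U e) (proj₁ P₁g)
  gc : adj U c g ≡ false
  gc = trans (≡-sym (−-miss (adj U c) (edge-≢ U (proj₁ eg) ∘ ≡-sym)))
         (trans (≡-sym (−-miss Q₁ (col-≢ U (proj₁ eg) (flip U be)))) (proj₂ (proj₂ pick₂)))

-- Inside a unigraph H, with degrees r + 1 on a, b and r on c, f, g, the vertices f and g would be
-- adjacent twins over a; switching the edge fg away destroys this but not what forces it.
no-twin-pendants : ∀ {n} (H : Graph n) → Unigraph H → ∀ {a b c f g} →
  adj H a b ≡ true → adj H b c ≡ true → adj H a c ≡ false →
  dg H b ≡ suc (dg H c) → dg H a ≡ suc (dg H c) → dg H f ≡ dg H c → dg H g ≡ dg H c →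
  f ≢ g → f ≢ c → g ≢ c → adj H c f ≡ false → adj H c g ≡ false → ⊥
no-twin-pendants H uH {a} {b} {c} {f} {g} ab bc ac db da df dg′ f≢g f≢c g≢c cf cg =
  true≢false (trans (≡-sym twin′) ga′) (flip switched xy′)
  where
  b≁ : ∀ {u v} → dg H u ≡ suc (dg H c) → dg H v ≡ dg H c → dg H u ≢ dg H v
  b≁ du dv e = 1+n≢n (trans (≡-sym du) (trans e dv))
  ≢-of : ∀ {u v} → dg H u ≡ suc (dg H c) → dg H v ≡ dg H c → u ≢ v
  ≢-of du dv refl = b≁ du dv refl
  low : ∀ {y} → dg H y ≡ dg H c → y ≢ c → adj H c y ≡ false → adj H y b ≡ false
  low dy y≢c cy = trans (same-low-neighbours H uH ab bc ac db (b≁ da refl) dy y≢c) (flip H cy)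
  fb = low df f≢c cf
  gb = low dg′ g≢c cg
  a≢c : a ≢ c
  a≢c = ≢-of da refl
  -- Dual to `low`: in the complement c, y, b is an induced path with `b` one degree below `y`, so
  -- `a`, which there has the degree of `b` and misses `b`, also misses `y`.
  high : ∀ {y} → dg H y ≡ dg H c → y ≢ c → adj H c y ≡ false → adj H y b ≡ false → adj H a y ≡ true
  high {y} dy y≢c cy yb with adj H a y in ay
  ... | true  = refl
  ... | false = ⊥-elim (true≢false (co-adj H (≢-of da dy) ay)
        (trans (same-low-neighbours (co H) (co-unigraph H uH)
                 (co-adj H (y≢c ∘ ≡-sym) cy) (co-adj H (≢-of db dy ∘ ≡-sym) yb)
                 (co-adj H (edge-≢ H bc ∘ ≡-sym) (flip H bc))
                 (co-dg-suc H (trans db (cong suc (≡-sym dy))))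
                 (λ e → 1+n≢n (trans (≡-sym (co-dg-suc H db)) e))
                 (co-dg-≡ H (trans da (≡-sym db))) (edge-≢ H ab))
               (co-adj H (edge-≢ H ab) ab)))
  af = high df f≢c cf fb
  ag = high dg′ g≢c cg gb
  twin : adj H g a ≡ adj H g f
  twin = same-low-neighbours H uH (flip H ab) af (flip H fb) (trans da (cong suc (≡-sym df))) (b≁ db df)
           (trans dg′ (≡-sym df)) (f≢g ∘ ≡-sym)
  open Switch H (alternating (flip H (trans (≡-sym twin) (flip H ag))) gb bc cf (≢-of db dg′ ∘ ≡-sym) (f≢c ∘ ≡-sym))
  a-row = off-row (≢-of da df) (≢-of da dg′) (edge-≢ H ab) a≢c
  ga′ : adj switched g a ≡ true
  ga′ = flip switched (trans (a-row g) ag)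
  d′ = λ u v (e : dg H u ≡ dg H v) → trans (switched-dg u) (trans e (≡-sym (switched-dg v)))
  twin′ : adj switched g a ≡ adj switched g f
  twin′ = same-low-neighbours switched (Unigraph-transport H switched uH switched-dg)
    (flip switched (trans (a-row b) ab)) (trans (a-row f) af)
    (trans (off-xz (inj₂ refl) f f≢g f≢c) (flip H fb))
    (trans (switched-dg a) (trans da (cong suc (trans (≡-sym df) (≡-sym (switched-dg f))))))
    (λ e → b≁ db df (trans (≡-sym (switched-dg b)) (trans e (switched-dg f))))
    (d′ g f (trans dg′ (≡-sym df))) (f≢g ∘ ≡-sym)

module _ {n} (U : Graph n) (uni : Unigraph U) where
  private d = dg U

  -- Inside the common degree class of `a`, `b`, `c`, switches against `e` show that `a` and `b`
  -- have inner degree one more than `c`, while the two extra neighbours of `e` have that of `c`.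
  -- The class is a unigraph, where `no-twin-pendants` forbids this.
  no-rising-end : ∀ {a b c e} → Path U a b c e → d a ≡ d c → d b ≡ d c → d c < d e → ⊥
  no-rising-end {a} {b} {c} {e} P da db c<e = result
    where
    open Path P
    p = d c
    e≁p : d e ≢ p
    e≁p = <⇒≢ c<e ∘ ≡-sym
    K : Fin n → Bool
    K u = d u ≡ⁿ p
    en = enumerate K
    open Enumeration en
    H = induce U at

    lone : ∀ {u} → adj U e u ≡ true → adj U c u ≡ false → u ≢ c → d u ≡ p
    lone eu cu u≢c with alternating-degrees U uni (alternating (flip U bc) bd eu (flip U cu) b≢d u≢c)
    ... | inj₁ c=e = ⊥-elim (e≁p (≡-sym c=e))
    ... | inj₂ b=u = trans (≡-sym b=u) db

    inner-b : within U K b ≡ suc (within U K c)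
    inner-b = class-degrees U uni p alt db da refl e≁p

    inner : ∀ {u} → adj U e u ≡ true → adj U c u ≡ false → u ≢ c → within U K u ≡ within U K c
    inner eu cu u≢c = suc-injective (trans (≡-sym
      (class-degrees U uni p (alternating bc cu (flip U eu) (flip U bd) (u≢c ∘ ≡-sym) (b≢d ∘ ≡-sym)) db refl (lone eu cu u≢c) e≁p))
      inner-b)

    -- `a` and `c` have equal degree and `e` is a neighbour of `c` only, so some `x` is a neighbour
    -- of `a` only. It completes the alternating cycle that compares `a` with `c`.
    extra = count-pick (adj U a) (adj U c − e)
              (subst (count (adj U c − e) <_) (trans (≡-sym (count-− (adj U c) cd)) (≡-sym da)) (n<1+n _))
    x = proj₁ extra
    ax : adj U a x ≡ true
    ax = proj₁ (proj₂ extra)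
    cx : adj U c x ≡ false
    cx = trans (≡-sym (−-miss (adj U c) (col-≢ U ax ad))) (proj₂ (proj₂ extra))
    x≢c : x ≢ c
    x≢c = col-≢ U ax ac
    dx : d x ≡ p
    dx with adj U e x in ex
    ... | true  = lone ex cx x≢c
    ... | false with alternating-degrees U uni (alternating ax (flip U ex) (flip U cd) (flip U ac) (col-≢ U ax ad) (a≢c ∘ ≡-sym))
    ...   | inj₁ a=e = ⊥-elim (e≁p (trans (≡-sym a=e) da))
    ...   | inj₂ x=c = x=c

    inner-a : within U K a ≡ suc (within U K c)
    inner-a = class-degrees U uni p (alternating ax (flip U cx) cd (flip U ad) x≢c (a≢d ∘ ≡-sym)) da dx refl e≁p

    in-K : ∀ {u} → d u ≡ p → ∃ λ i → at i ≡ u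
    in-K du = index _ (≡ⁿ-true du)

    core : ∀ {f g} → f ≢ g → adj U e f ≡ true × adj U c f ≡ false × f ≢ c → adj U e g ≡ true × adj U c g ≡ false × g ≢ c → ⊥
    core {f} {g} f≢g (ef , cf , f≢c) (eg , cg , g≢c) =
      go (in-K da) (in-K db) (in-K refl) (in-K (lone ef cf f≢c)) (in-K (lone eg cg g≢c))
      where
      deg : ∀ {i j} → within U K (at i) ≡ within U K (at j) → dg H i ≡ dg H j
      deg {i} {j} h = trans (within-dg U en i) (trans h (≡-sym (within-dg U en j)))
      deg⁺ : ∀ {i j} → within U K (at i) ≡ suc (within U K (at j)) → dg H i ≡ suc (dg H j)
      deg⁺ {i} {j} h = trans (within-dg U en i) (trans h (cong suc (≡-sym (within-dg U en j))))
      go : (∃ λ i → at i ≡ a) → (∃ λ i → at i ≡ b) → (∃ λ i → at i ≡ c) → (∃ λ i → at i ≡ f) → (∃ λ i → at i ≡ g) → ⊥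
      go (i , ia) (j , jb) (k , kc) (l , lf) (m , mg) =
        no-twin-pendants H (class-unigraph U uni p en) {i} {j} {k} {l} {m}
          (tr ia jb ab) (tr jb kc bc) (tr ia kc ac)
          (deg⁺ (wi jb kc inner-b)) (deg⁺ (wi ia kc inner-a))
          (deg (wi′ lf kc (inner ef cf f≢c))) (deg (wi′ mg kc (inner eg cg g≢c)))
          (ne lf mg f≢g) (ne lf kc f≢c) (ne mg kc g≢c)
          (tr kc lf cf) (tr kc mg cg)
        where
        tr : ∀ {i j u v β} → at i ≡ u → at j ≡ v → adj U u v ≡ β → adj U (at i) (at j) ≡ β
        tr refl refl h = h
        wi : ∀ {i j u v} → at i ≡ u → at j ≡ v → within U K u ≡ suc (within U K v) → within U K (at i) ≡ suc (within U K (at j))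
        wi refl refl h = h
        wi′ : ∀ {i j u v} → at i ≡ u → at j ≡ v → within U K u ≡ within U K v → within U K (at i) ≡ within U K (at j)
        wi′ refl refl h = h
        ne : ∀ {i j u v} → at i ≡ u → at j ≡ v → u ≢ v → i ≢ j
        ne refl refl h refl = h refl

    result : ⊥
    result with f , g , f≢g , hf , hg ← two-extra U b≢d bc bd cd c<e = core f≢g hf hg

-- By `alternating-degrees` either the two middle vertices or the two ends agree in degree. Unless
-- all four agree, one end rises above three equal vertices, up to reversal in the first case; in
-- the second this happens on the complementary path.
path-degrees : ∀ {n} (U : Graph n) → Unigraph U → ∀ {a b c d} → Path U a b c d →
               dg U b ≤ dg U a → dg U c ≤ dg U d → dg U a ≡ dg U b × dg U b ≡ dg U c × dg U c ≡ dg U d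
path-degrees U uni {a} {b} {c} {d} P b≤a c≤d
  with m≤n⇒m<n∨m≡n b≤a | m≤n⇒m<n∨m≡n c≤d | alternating-degrees U uni (Path.alt P)
... | inj₁ b<a | inj₁ c<d | _ = ⊥-elim (no-double-descent U uni P b<a c<d)
... | inj₂ b=a | inj₂ c=d | inj₁ b=c = ≡-sym b=a , b=c , c=d
... | inj₂ b=a | inj₂ c=d | inj₂ a=d = ≡-sym b=a , trans b=a (trans a=d (≡-sym c=d)) , c=d
... | inj₂ b=a | inj₁ c<d | inj₁ b=c = ⊥-elim (no-rising-end U uni P (trans (≡-sym b=a) b=c) b=c c<d)
... | inj₁ b<a | inj₂ c=d | inj₁ b=c =
      ⊥-elim (no-rising-end U uni (reverse P) (trans (≡-sym c=d) (≡-sym b=c)) (≡-sym b=c) b<a)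
... | inj₂ b=a | inj₁ c<d | inj₂ a=d =
      ⊥-elim (no-rising-end (co U) (co-unigraph U uni) (co-path P) (co-dg-≡ U b=a) (co-dg-≡ U (≡-sym a=d))
        (co-dg-< U (subst (dg U c <_) (≡-sym a=d) c<d)))
... | inj₁ b<a | inj₂ c=d | inj₂ a=d =
      ⊥-elim (no-rising-end (co U) (co-unigraph U uni) (co-path (reverse P)) (co-dg-≡ U c=d) (co-dg-≡ U a=d)
        (co-dg-< U (subst (dg U b <_) a=d b<a)))

-- Regular unigraphs

Regular : ∀ {n} → Graph n → ℕ → Set
Regular G r = ∀ v → dg G v ≡ r

opaque
  unfolding count

  range-+ : ∀ a b (s : ℕ → Bool) → count {a + b} (s ∘ toℕ) ≡ count {a} (s ∘ toℕ) + count {b} (λ i → s (a + toℕ i))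
  range-+ zero    b s = refl
  range-+ (suc a) b s = trans (cong (bit (s 0) +_) (range-+ a b (s ∘ suc))) (≡-sym (+-assoc (bit (s 0)) _ _))

  count-all : ∀ {n} {P : Fin n → Bool} → (∀ i → P i ≡ true) → count P ≡ n
  count-all {zero}  h = refl
  count-all {suc n} h rewrite h zero = cong suc (count-all (h ∘ suc))

  count-none : ∀ {n} {P : Fin n → Bool} → (∀ i → P i ≡ false) → count P ≡ 0
  count-none {zero}  h = refl
  count-none {suc n} h rewrite h zero = count-none (h ∘ suc)

  sum-const : ∀ n r → sum {n} (λ _ → r) ≡ n * r
  sum-const zero    r = refl
  sum-const (suc n) r = cong (r +_) (sum-const n r)

  -- Row and column of the first vertex contribute equally; the rest is the graph without it.
  handshake : ∀ {n} (G : Graph n) → 2 ∣ sum (dg G)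
  handshake {zero}  G = 2 ∣0
  handshake {suc n} G = subst (2 ∣_) (≡-sym total) (∣m∣n⇒∣m+n (divides X (trans (cong (X +_) (≡-sym (+-identityʳ X))) (*-comm 2 X)))
                                       (handshake (induce G suc)))
    where
    X Y : ℕ
    X = count (λ j → adj G zero (suc j))
    Y = sum (dg (induce G suc))
    total : sum (dg G) ≡ (X + X) + Y
    total = trans (cong₂ _+_ (cong (λ b → bit b + X) (irrefl G zero))
                    (trans (∑-distrib-+ (λ i → bit (adj G (suc i) zero)) (dg (induce G suc)))
                      (cong (_+ Y) (count-cong (λ i → sym G (suc i) zero)))))
                  (≡-sym (+-assoc X X Y))

rotate-succ : ∀ {m} → Fin (suc m) → Fin (suc m)
rotate-succ {m} i with toℕ i <? m
... | yes p = suc (fromℕ< p)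
... | no _  = zero

rotate-view : ∀ {m} (i : Fin (suc m)) →
              (toℕ (rotate-succ i) ≡ suc (toℕ i)) ⊎ (toℕ i ≡ m × rotate-succ i ≡ zero)
rotate-view {m} i with toℕ i <? m
... | yes p = inj₁ (cong suc (toℕ-fromℕ< p))
... | no ¬p = inj₂ (≤-antisym (s≤s⁻¹ (toℕ<n i)) (≮⇒≥ ¬p) , refl)

rotate-inject₁ : ∀ {m} (i : Fin m) → rotate-succ (inject₁ i) ≡ suc i
rotate-inject₁ {m} i with rotate-view (inject₁ i)
... | inj₁ e = toℕ-injective (trans e (cong suc (toℕ-inject₁ i)))
... | inj₂ (e , _) = ⊥-elim (<-irrefl (trans (≡-sym (toℕ-inject₁ i)) e) (toℕ<n i))

rotate-injective : ∀ {m} {i j : Fin (suc m)} → rotate-succ i ≡ rotate-succ j → i ≡ j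
rotate-injective {i = i} {j} e with rotate-view i | rotate-view j
... | inj₁ p | inj₁ q = toℕ-injective (suc-injective (trans (≡-sym p) (trans (cong toℕ e) q)))
... | inj₂ (p , _) | inj₂ (q , _) = toℕ-injective (trans p (≡-sym q))
... | inj₁ p | inj₂ (_ , q) with () ← trans (≡-sym p) (cong toℕ (trans e q))
... | inj₂ (_ , p) | inj₁ q with () ← trans (≡-sym q) (cong toℕ (trans (≡-sym e) p))

rotation : ∀ {m} → Fin (suc m) ↔ Fin (suc m)
rotation = injective⇒↔ rotate-succ rotate-injective

RotationInvariant : ∀ {m} → Graph (suc m) → Set
RotationInvariant G = ∀ i j → adj G i j ≡ adj G (rotate-succ i) (rotate-succ j)

rotation-constant : ∀ {m} {A : Set} (f : Fin (suc m) → A) → (∀ i → f (rotate-succ i) ≡ f i) → ∀ i → f i ≡ f zero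
rotation-constant f h = <-weakInduction (λ i → f i ≡ f zero) refl
  (λ i e → trans (cong f (≡-sym (rotate-inject₁ i))) (trans (h (inject₁ i)) e))

module Circulant (m h : ℕ) where
  -- Positive distance at most `h` around a cycle of length `suc m`, in one direction or the other;
  -- the second bound is stated without subtraction.
  Near : ℕ → Set
  Near k = 1 ≤ k × (k ≤ h ⊎ suc m ≤ k + h)

  near? : ∀ k → Dec (Near k)
  near? k = (1 ≤? k) ×-dec ((k ≤? h) ⊎-dec (suc m ≤? k + h))

  circulant : Graph (suc m)
  adj    circulant i j = does (near? ∣ toℕ i - toℕ j ∣)
  sym    circulant i j = cong (does ∘ near?) (ℕ.∣-∣-comm (toℕ i) (toℕ j))
  irrefl circulant i   = cong (does ∘ near?) (ℕ.∣n-n∣≡0 (toℕ i))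

  private
    -- `k` and `l` are the two ways round the cycle between the same vertices. A rotation in which
    -- just one of two vertices wraps around replaces one by the other.
    reflect : ∀ {k l} → k + l ≡ suc m → 1 ≤ l → Near k → Near l
    reflect {k} {l} e 1≤l (_ , inj₁ k≤h) = 1≤l , inj₂ (subst (_≤ l + h) (trans (+-comm l k) e) (ℕ.+-monoʳ-≤ l k≤h))
    reflect {k} {l} e 1≤l (_ , inj₂ le) = 1≤l , inj₁ (ℕ.+-cancelˡ-≤ k l h (subst (_≤ k + h) (≡-sym e) le))

    mirror : ∀ {k l} → k + l ≡ suc m → 1 ≤ k → 1 ≤ l → does (near? k) ≡ does (near? l)
    mirror {k} {l} e 1≤k 1≤l = bool-ext
      (λ t → dec-true (near? l) (reflect e 1≤l (does-sound (near? k) t)))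
      (λ t → dec-true (near? k) (reflect (trans (+-comm l k) e) 1≤k (does-sound (near? l) t)))

    wrap : ∀ (i j : Fin (suc m)) → toℕ i ≡ m → toℕ (rotate-succ j) ≡ suc (toℕ j) →
           does (near? ∣ toℕ i - toℕ j ∣) ≡ does (near? (suc (toℕ j)))
    wrap i j p q = mirror (trans (cong (_+ suc (toℕ j)) dist) (trans (+-suc _ _) (cong suc (ℕ.m∸n+n≡m j≤m))))
                          (subst (1 ≤_) (≡-sym dist) (ℕ.m<n⇒0<n∸m j<m)) (s≤s z≤n)
      where
      j<m : toℕ j < m
      j<m = s≤s⁻¹ (subst (_< suc m) q (toℕ<n (rotate-succ j)))
      j≤m = <⇒≤ j<m
      dist : ∣ toℕ i - toℕ j ∣ ≡ m ∸ toℕ j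
      dist = trans (cong (∣_- toℕ j ∣) p) (ℕ.m≤n⇒∣n-m∣≡n∸m j≤m)

  circulant-invariant : RotationInvariant circulant
  circulant-invariant i j with rotate-view i | rotate-view j
  ... | inj₁ p | inj₁ q rewrite p | q = refl
  ... | inj₂ (p , p′) | inj₂ (q , q′) = cong (does ∘ near?)
        (trans (trans (cong₂ ∣_-_∣ p q) (ℕ.∣n-n∣≡0 m)) (≡-sym (cong₂ (λ x y → ∣ toℕ x - toℕ y ∣) p′ q′)))
  ... | inj₂ (p , p′) | inj₁ q = trans (wrap i j p q)
        (cong (does ∘ near?) (trans (≡-sym q) (≡-sym (cong (λ x → ∣ toℕ x - toℕ (rotate-succ j) ∣) p′))))
  ... | inj₁ q | inj₂ (p , p′) = trans (sym circulant i j) (trans (wrap j i p q)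
        (trans (cong (does ∘ near?) (trans (≡-sym q) (≡-sym (cong (λ x → ∣ toℕ x - toℕ (rotate-succ i) ∣) p′))))
               (sym circulant (rotate-succ j) (rotate-succ i))))

  -- The row of vertex zero consists of itself, `h` neighbours, `k` nonneighbours and again `h`
  -- neighbours.
  circulant-dg₀ : ∀ k → m ≡ h + (k + h) → dg circulant zero ≡ h + h
  circulant-dg₀ k refl =
    trans (range-+ 1 (h + (k + h)) s)
      (cong₂ _+_ (count-none {1} (λ { zero → refl }))
        (trans (range-+ h (k + h) (s ∘ suc))
          (cong₂ _+_ (count-all {h} λ i → dec-true (near? _) (s≤s z≤n , inj₁ (toℕ<n i)))
            (trans (range-+ k h (λ i → s (suc (h + i))))
              (cong₂ _+_ (count-none {k} λ i → dec-false (near? _) (middle i))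
                         (count-all {h} λ i → dec-true (near? _) (s≤s z≤n , inj₂ (s≤s (last i)))))))))
    where
    s = does ∘ near?
    middle : ∀ (i : Fin k) → ¬ Near (suc (h + toℕ i))
    middle i (_ , inj₁ le) = ℕ.≤⇒≯ (ℕ.m≤m+n h (toℕ i)) le
    middle i (_ , inj₂ (s≤s le)) = ℕ.<-irrefl refl (ℕ.≤-<-trans le
      (subst (_< h + (k + h)) (≡-sym (+-assoc h (toℕ i) h)) (ℕ.+-monoʳ-< h (ℕ.+-monoˡ-< h (toℕ<n i)))))
    last : ∀ (i : Fin h) → h + (k + h) ≤ h + (k + toℕ i) + h
    last i = subst (_≤ h + (k + toℕ i) + h) (+-assoc h k h)
      (ℕ.+-monoˡ-≤ h (ℕ.+-monoʳ-≤ h (ℕ.m≤m+n k (toℕ i))))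

invariant-regular : ∀ {m} (G : Graph (suc m)) → RotationInvariant G → Regular G (dg G zero)
invariant-regular G inv = rotation-constant (dg G) (≅-dg G G (rotation , inv))

co-invariant : ∀ {m} (G : Graph (suc m)) → RotationInvariant G → RotationInvariant (co G)
co-invariant G inv i j with eq? i j
... | inj₁ refl = trans (irrefl (co G) i) (≡-sym (irrefl (co G) _))
... | inj₂ ij = trans (co-adj G ij (inv i j)) (≡-sym (co-adj G (ij ∘ rotate-injective) refl))

even⊎odd : ∀ r → 2 ∣ r ⊎ 2 ∣ suc r
even⊎odd zero    = inj₁ (2 ∣0)
even⊎odd (suc r) with even⊎odd r
... | inj₁ e = inj₂ (∣m∣n⇒∣m+n ∣-refl e)
... | inj₂ e = inj₁ e

even-circulant : ∀ m {r} → 2 ∣ r → r ≤ m → ∃ λ (C : Graph (suc m)) → RotationInvariant C × Regular C r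
even-circulant m {r} (divides q e) r≤m =
  circulant , circulant-invariant , λ v → trans (invariant-regular circulant circulant-invariant v) dg₀
  where
  open Circulant m q
  r≡q+q : q + q ≡ r
  r≡q+q = trans (cong (q +_) (≡-sym (+-identityʳ q))) (trans (*-comm 2 q) (≡-sym e))
  k = m ∸ (q + q)
  dg₀ : dg circulant zero ≡ r
  dg₀ = trans (circulant-dg₀ k (trans (≡-sym (m+[n∸m]≡n (subst (_≤ m) (≡-sym r≡q+q) r≤m)))
                (trans (+-assoc q q k) (cong (q +_) (+-comm q k))))) r≡q+q

-- Circulants of this kind have even degree. If `r` is odd, the handshake lemma makes the order
-- even, so the complementary degree `s` is even and the complement of a circulant serves.
invariant-realization : ∀ {m} (U : Graph (suc m)) {r} → Regular U r →
                        ∃ λ (C : Graph (suc m)) → RotationInvariant C × Regular C r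
invariant-realization {m} U {r} reg = by-parity
    (euclidsLemma (suc m) r prime[2] (subst (2 ∣_) (trans (sum-cong-≗ reg) (sum-const (suc m) r)) (handshake U)))
    (even⊎odd r)
  where
  s = dg (co U) zero
  r+s : suc r + s ≡ suc m
  r+s = trans (≡-sym (+-suc r s)) (trans (cong (_+ suc s) (≡-sym (reg zero))) (co-dg U zero))
  r≤m : r ≤ m
  r≤m = subst (r ≤_) (suc-injective r+s) (ℕ.m≤m+n r s)
  s≤m : s ≤ m
  s≤m = subst (s ≤_) (suc-injective r+s) (ℕ.m≤n+m s r)
  by-parity : 2 ∣ suc m ⊎ 2 ∣ r → 2 ∣ r ⊎ 2 ∣ suc r → ∃ λ (C : Graph (suc m)) → RotationInvariant C × Regular C r
  by-parity _ (inj₁ e) = even-circulant m e r≤m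
  by-parity (inj₂ e) _ = even-circulant m e r≤m
  by-parity (inj₁ e) (inj₂ o)
    with C , inv , regC ← even-circulant m (∣m+n∣m⇒∣n (subst (2 ∣_) (≡-sym r+s) e) o) s≤m =
    co C , co-invariant C inv , λ v → ℕ.+-cancelˡ-≡ (suc s) _ _
      (trans (≡-sym (+-suc s _)) (trans (cong (_+ suc (dg (co C) v)) (≡-sym (regC v)))
        (trans (co-dg C v) (trans (≡-sym r+s) (cong suc (+-comm r s))))))

-- Triangle counts in regular unigraphs

triangle : ∀ {n} → Graph n → Fin n → Fin n → Fin n → Bool
triangle G v x y = adj G v x ∧ (adj G v y ∧ adj G x y)

triangle-true : ∀ {n} (G : Graph n) {v} x y → triangle G v x y ≡ true →
                adj G v x ≡ true × adj G v y ≡ true × adj G x y ≡ true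
triangle-true G {v} x y h with p , h′ ← ∧-true {adj G v x} h with q , r ← ∧-true {adj G v y} h′ = p , q , r

triangle-intro : ∀ {n} (G : Graph n) {v} x y → adj G v x ≡ true → adj G v y ≡ true → adj G x y ≡ true →
                 triangle G v x y ≡ true
triangle-intro G x y p q r = ∧-intro p (∧-intro q r)

-- Counts ordered pairs, hence each triangle at `v` twice.
triangles : ∀ {n} → Graph n → Fin n → ℕ
triangles G v = count₂ (triangle G v)

≅-triangles : ∀ {m n} (G : Graph m) (H : Graph n) ((φ , _) : G ≅ H) → ∀ v → triangles G v ≡ triangles H (Inverse.to φ v)
≅-triangles G H (φ , pres) v = count₂-permute φ _ _ λ x y →
  cong₂ _∧_ (pres v x) (cong₂ _∧_ (pres v y) (pres x y))

-- A regular unigraph is isomorphic to a circulant graph or the complement of one, hence vertex-transitive.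
triangles-constant : ∀ {n} (U : Graph n) → Unigraph U → ∀ {r} → Regular U r →
                     ∀ H → Regular H r → ∀ v → triangles H v ≡ triangles U v
triangles-constant {suc m} U uni {r} reg H regH v = trans (to-C H regH v) (≡-sym (to-C U reg v))
  where
  real = invariant-realization U reg
  C = proj₁ real
  regC = proj₂ (proj₂ real)
  C-const : ∀ v → triangles C v ≡ triangles C zero
  C-const = rotation-constant (triangles C) (λ i → ≡-sym (≅-triangles C C (rotation , proj₁ (proj₂ real)) i))
  to-C : ∀ H → Regular H r → ∀ v → triangles H v ≡ triangles C zero
  to-C H regH v = trans (≅-triangles H U (≅-sym U H UH) v) (trans (≅-triangles U C UC _) (C-const _))
    where
    UH : U ≅ H
    UH = realizes-id U uni H (λ v → trans (regH v) (≡-sym (reg v)))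
    UC : U ≅ C
    UC = realizes-id U uni C (λ v → trans (regC v) (≡-sym (reg v)))

module _ {n} (U : Graph n) (uni : Unigraph U) {r} (reg : Regular U r) where

  private
    rigid : ∀ H → (∀ v → dg H v ≡ dg U v) → ∀ v → triangles H v ≡ triangles U v
    rigid H h = triangles-constant U uni reg H (λ v → trans (h v) (reg v))

    -- Otherwise switching on c, u, b, a destroys the triangle d, c, u. Both new edges, ub and ac,
    -- contain a nonneighbour of `d`, so no triangle at `d` appears.
    backward : ∀ {a b c d u} → Path U a b c d → adj U d u ≡ true → adj U c u ≡ true → adj U b u ≡ true
    backward {a} {b} {c} {d} {u} P du cu with adj U b u in bu
    ... | true  = refl
    ... | false = ⊥-elim (<-irrefl (rigid switched switched-dg d) (count₂-strict _ _ sub c u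
            (¬true⇒false λ h → true≢false (proj₂ (proj₂ (triangle-true switched c u h))) xy′)
            (triangle-intro U c u (flip U cd) du cu)))
      where
      open Path P
      u≢b : u ≢ b
      u≢b = col-≢ U du (flip U bd)
      open Switch U (alternating cu (flip U bu) (flip U ab) ac u≢b a≢c)
      d-row = off-row (c≢d ∘ ≡-sym) (edge-≢ U du) (b≢d ∘ ≡-sym) (a≢d ∘ ≡-sym)
      near : ∀ x y → adj U d x ≡ true → adj U d y ≡ true → adj switched x y ≡ true → adj U x y ≡ true
      near x y dx dy e with view x y
      ... | inj₁ same = trans (≡-sym same) e
      ... | inj₂ (inj₁ (inj₁ refl , inj₁ refl)) = cu
      ... | inj₂ (inj₁ (inj₂ refl , _)) = ⊥-elim (true≢false dx (flip U bd))
      ... | inj₂ (inj₁ (_ , inj₂ refl)) = ⊥-elim (true≢false dy (flip U ad))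
      ... | inj₂ (inj₂ (inj₁ refl , inj₁ refl)) = flip U cu
      ... | inj₂ (inj₂ (inj₂ refl , _)) = ⊥-elim (true≢false dx (flip U ad))
      ... | inj₂ (inj₂ (_ , inj₂ refl)) = ⊥-elim (true≢false dy (flip U bd))
      sub : ∀ x y → triangle switched d x y ≡ true → triangle U d x y ≡ true
      sub x y h with p , q , e ← triangle-true switched x y h
                with dx ← trans (≡-sym (d-row x)) p | dy ← trans (≡-sym (d-row y)) q =
        triangle-intro U x y dx dy (near x y dx dy e)

    -- Switching along the path replaces the neighbour `c` of `d` by `b`, which is then renamed `c`.
    -- By `backward` every triangle at `d` survives, so a `u` joined to `b` alone would add one.
    forward : ∀ {a b c d u} → Path U a b c d → adj U d u ≡ true → u ≢ c → adj U b u ≡ true → adj U c u ≡ true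
    forward {a} {b} {c} {d} {u} P du u≢c bu with adj U c u in cu
    ... | true  = refl
    ... | false = ⊥-elim (<-irrefl (≡-sym (rigid R R-dg d)) (count₂-strict _ _ sub c u
            (¬true⇒false λ h → true≢false (proj₂ (proj₂ (triangle-true U c u h))) cu)
            (triangle-intro R {d} c u (R-d (flip U cd)) (R-d du) (trans (R-row du u≢c) bu))))
      where
      open Path P
      open Switch U alt
      τ = transpose b c
      R = relabel switched τ
      R-dg : ∀ v → dg R v ≡ dg U v
      R-dg v = trans (relabel-dg switched τ v) (trans (switched-dg _) (trans (reg _) (≡-sym (reg v))))
      fixed : ∀ {x} → adj U d x ≡ true → x ≢ c → Inverse.to τ x ≡ x
      fixed dx xc = transpose-other (col-≢ U dx (flip U bd)) xc
      d-fixed : Inverse.to τ d ≡ d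
      d-fixed = transpose-other (b≢d ∘ ≡-sym) (c≢d ∘ ≡-sym)
      R-d : ∀ {x} → adj U d x ≡ true → adj R d x ≡ true
      R-d {x} dx with eq? x c
      ... | inj₁ refl = trans (cong₂ (adj switched) d-fixed (transpose-right b c)) wx′
      ... | inj₂ xc = trans (cong₂ (adj switched) d-fixed (fixed dx xc))
                        (trans (off-yw (inj₂ refl) x (col-≢ U dx (flip U bd)) xc) dx)
      R-row : ∀ {x} → adj U d x ≡ true → x ≢ c → adj R c x ≡ adj U b x
      R-row {x} dx xc = trans (cong₂ (adj switched) (transpose-right b c) (fixed dx xc))
                          (off-xz (inj₁ refl) x (col-≢ U dx (flip U ad)) (edge-≢ U dx ∘ ≡-sym))
      near : ∀ x y → adj U d x ≡ true → adj U d y ≡ true → adj U x y ≡ true → adj R x y ≡ true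
      near x y dx dy e with eq? x c | eq? y c
      ... | inj₁ refl | inj₁ refl = ⊥-elim (edge-≢ U e refl)
      ... | inj₁ refl | inj₂ yc = trans (R-row dy yc) (backward P dy e)
      ... | inj₂ xc | inj₁ refl = trans (sym R x y) (trans (R-row dx xc) (backward P dx (flip U e)))
      ... | inj₂ xc | inj₂ yc = trans (cong₂ (adj switched) (fixed dx xc) (fixed dy yc))
              (trans (off-row (col-≢ U dx (flip U bd)) (col-≢ U dx (flip U ad)) xc (edge-≢ U dx ∘ ≡-sym) y) e)
      sub : ∀ x y → triangle U d x y ≡ true → triangle R d x y ≡ true
      sub x y h with p , q , e ← triangle-true U x y h = triangle-intro R {d} x y (R-d p) (R-d q) (near x y p q e)

  same-end-neighbours : ∀ {a b c d u} → Path U a b c d → adj U d u ≡ true → u ≢ c → adj U b u ≡ adj U c u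
  same-end-neighbours P du u≢c = bool-ext (forward P du u≢c) (backward P du)

-- Pentagons

record Pentagon {n} (G : Graph n) (v w x y z : Fin n) : Set where
  constructor pentagon
  field
    vw : adj G v w ≡ true
    wx : adj G w x ≡ true
    xy : adj G x y ≡ true
    yz : adj G y z ≡ true
    zv : adj G z v ≡ true
    vx : adj G v x ≡ false
    wy : adj G w y ≡ false
    xz : adj G x z ≡ false
    yv : adj G y v ≡ false
    zw : adj G z w ≡ false

  vwxy : Path G v w x y
  vwxy = path vw wx xy vx wy (flip G yv)

module _ {n} {G : Graph n} where
  open Pentagon

  turn : ∀ {v w x y z} → Pentagon G v w x y z → Pentagon G w x y z v
  turn (pentagon vw wx xy yz zv vx wy xz yv zw) = pentagon wx xy yz zv vw wy xz yv zw vx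

  co-pentagon : ∀ {v w x y z} → Pentagon G v w x y z → Pentagon (co G) v x z w y
  co-pentagon {v} {w} {x} {y} {z} c = pentagon
    (miss c) (miss (turn (turn c))) (miss (turn (turn (turn (turn c)))))
    (miss (turn c)) (miss (turn (turn (turn c))))
    (flip (co G) (hit (turn (turn (turn (turn c)))))) (flip (co G) (hit (turn c)))
    (flip (co G) (hit (turn (turn (turn c))))) (flip (co G) (hit c)) (flip (co G) (hit (turn (turn c))))
    where
    hit : ∀ {v w x y z} → Pentagon G v w x y z → adj (co G) v w ≡ false
    hit c = co-adj G (edge-≢ G (vw c)) (vw c)
    miss : ∀ {v w x y z} → Pentagon G v w x y z → adj (co G) v x ≡ true
    miss c = co-adj G (Path.a≢c (vwxy c)) (vx c)

record Outside {n} (v w x y z u : Fin n) : Set where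
  constructor outside
  field
    ≢v : u ≢ v
    ≢w : u ≢ w
    ≢x : u ≢ x
    ≢y : u ≢ y
    ≢z : u ≢ z

turn-outside : ∀ {n} {v w x y z u : Fin n} → Outside v w x y z u → Outside w x y z v u
turn-outside (outside a b c d e) = outside b c d e a

inside-or-outside : ∀ {n} (v w x y z u : Fin n) →
  (u ≡ v ⊎ u ≡ w ⊎ u ≡ x ⊎ u ≡ y ⊎ u ≡ z) ⊎ Outside v w x y z u
inside-or-outside v w x y z u with eq? u v | eq? u w | eq? u x | eq? u y | eq? u z
... | inj₁ e | _ | _ | _ | _ = inj₁ (inj₁ e)
... | inj₂ _ | inj₁ e | _ | _ | _ = inj₁ (inj₂ (inj₁ e))
... | inj₂ _ | inj₂ _ | inj₁ e | _ | _ = inj₁ (inj₂ (inj₂ (inj₁ e)))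
... | inj₂ _ | inj₂ _ | inj₂ _ | inj₁ e | _ = inj₁ (inj₂ (inj₂ (inj₂ (inj₁ e))))
... | inj₂ _ | inj₂ _ | inj₂ _ | inj₂ _ | inj₁ e = inj₁ (inj₂ (inj₂ (inj₂ (inj₂ e))))
... | inj₂ a | inj₂ b | inj₂ c | inj₂ d | inj₂ e = inj₂ (outside a b c d e)

Step : ∀ {n} → Graph n → Set
Step G = ∀ {v w x y z u} → Pentagon G v w x y z → Outside v w x y z u → adj G u v ≡ true → adj G u w ≡ true

record Homogeneous {n} (G : Graph n) (v w x y z u : Fin n) (b : Bool) : Set where
  constructor homogeneous
  field
    uv : adj G u v ≡ b
    uw : adj G u w ≡ b
    ux : adj G u x ≡ b
    uy : adj G u y ≡ b
    uz : adj G u z ≡ b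

-- `Step` speaks of every pentagon, so turning this one carries the implication once round the cycle
-- and makes all five adjacencies equivalent.
step⇒homogeneous : ∀ {n} {G : Graph n} → Step G → ∀ {v w x y z u b} → Pentagon G v w x y z →
                   Outside v w x y z u → adj G u v ≡ b → Homogeneous G v w x y z u b
step⇒homogeneous {G = G} step {v} {w} {x} {y} {z} {u} {b} c o uv =
  homogeneous uv (to w v→w w→v) (to x (w→x ∘ v→w) (w→v ∘ x→w)) (to y (x→y ∘ w→x ∘ v→w) (z→v ∘ y→z))
              (to z (y→z ∘ x→y ∘ w→x ∘ v→w) z→v)
  where
  c₁ = turn c
  c₂ = turn c₁
  c₃ = turn c₂
  c₄ = turn c₃
  o₁ = turn-outside o
  o₂ = turn-outside o₁
  o₃ = turn-outside o₂
  o₄ = turn-outside o₃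
  v→w = step c o
  w→x = step c₁ o₁
  x→y = step c₂ o₂
  y→z = step c₃ o₃
  z→v = step c₄ o₄
  w→v = z→v ∘ y→z ∘ x→y ∘ w→x
  x→w = v→w ∘ z→v ∘ y→z ∘ x→y
  to : ∀ t → (adj G u v ≡ true → adj G u t ≡ true) → (adj G u t ≡ true → adj G u v ≡ true) → adj G u t ≡ b
  to t f g = trans (bool-ext g f) uv

co-regular : ∀ {n} (U : Graph n) {r} → Regular U r → ∀ w → Regular (co U) (dg (co U) w)
co-regular U reg w v = co-dg-≡ U (trans (reg v) (≡-sym (reg w)))

module _ {n} (U : Graph n) (uni : Unigraph U) {r} (reg : Regular U r) where

  same-end-nonneighbours : ∀ {a b c d u} → Path U a b c d → adj U c u ≡ false → u ≢ a → u ≢ c → u ≢ d →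
                           adj U d u ≡ adj U a u
  same-end-nonneighbours {a} {b} {c} {d} {u} P cu ua uc ud = not-injective
    (trans (≡-sym (co-adj U (ud ∘ ≡-sym) refl))
      (trans (same-end-neighbours (co U) (co-unigraph U uni) (co-regular U reg a) (co-path P) (co-adj U (uc ∘ ≡-sym) cu) ua)
             (co-adj U (ua ∘ ≡-sym) refl)))

  -- By regularity `a` has a neighbour `f` other than `b` outside the neighbourhood of `b`, because
  -- `c` uses up a place there. The two end lemmas then make `f` miss `c` and meet `d`.
  path-closes : ∀ {a b c d} → Path U a b c d → ∃ λ f → Pentagon U a b c d f
  path-closes {a} {b} {c} {d} P = f , pentagon ab bc cd (flip U fd) (flip U af) ac bd cf (flip U ad) (flip U bf)
    where
    open Path P
    lt : count (adj U b − a − c) < count (adj U a − b)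
    lt = subst (count (adj U b − a − c) <_) (suc-injective
      (trans (cong suc (≡-sym (count-− (adj U b − a) (trans (−-miss (adj U b) (a≢c ∘ ≡-sym)) bc))))
        (trans (≡-sym (count-− (adj U b) (flip U ab))) (trans (reg b) (trans (≡-sym (reg a)) (count-− (adj U a) ab))))))
      (n<1+n _)
    pick = count-pick (adj U a − b) (adj U b − a − c) lt
    f = proj₁ pick
    af = proj₁ (−-true (adj U a) (proj₁ (proj₂ pick)))
    f≢b = proj₂ (−-true (adj U a) (proj₁ (proj₂ pick)))
    f≢a = edge-≢ U af ∘ ≡-sym
    f≢c = col-≢ U af ac
    f≢d = col-≢ U af ad
    bf : adj U b f ≡ false
    bf = trans (≡-sym (trans (−-miss (adj U b − a) f≢c) (−-miss (adj U b) f≢a))) (proj₂ (proj₂ pick))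
    cf : adj U c f ≡ false
    cf = trans (same-end-neighbours U uni reg (reverse P) af f≢b) bf
    fd : adj U f d ≡ true
    fd = flip U (trans (same-end-nonneighbours P cf f≢a f≢c f≢d) af)

  -- If `u` met `v` but missed `w`, the end lemmas on paths of the pentagon would make it meet `y`
  -- and miss `x`, hence `z`; but the path w, v, z, y requires it to treat `v` and `z` alike.
  regular-step : Step U
  regular-step {v} {w} {x} {y} {z} {u} c (outside ≢v ≢w ≢x ≢y ≢z) uv with adj U u w in uw
  ... | true  = refl
  ... | false = ⊥-elim (true≢false
        (trans (≡-sym (same-end-neighbours U uni reg wvzy yu ≢z)) vu) zu)
    where
    open Pentagon (turn (turn (turn (turn c)))) using () renaming (vwxy to zvwx)
    yxwv = reverse (Pentagon.vwxy c)
    wvzy = reverse (Pentagon.vwxy (turn (turn (turn c))))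
    vu = flip U uv
    wu = flip U uw
    yu : adj U y u ≡ true
    yu = trans (≡-sym (same-end-nonneighbours yxwv wu ≢y ≢w ≢v)) vu
    xu : adj U x u ≡ false
    xu = trans (same-end-neighbours U uni reg yxwv vu ≢w) wu
    zu : adj U z u ≡ false
    zu = trans (≡-sym (same-end-nonneighbours zvwx wu ≢z ≢w ≢x)) xu

module _ {n} (U : Graph n) (uni : Unigraph U) {r} (reg : Regular U r) where

  -- Switching the edge og with the side wx destroys the pentagon but not the path xyzv, which cannot close up again.
  no-far-edge : ∀ {v w x y z o g} → Pentagon U v w x y z → Outside v w x y z o → Outside v w x y z g →
                adj U v o ≡ false → adj U v g ≡ false → adj U o g ≡ true → ⊥
  no-far-edge {v} {w} {x} {y} {z} {o} {g} c oo og vo vg o~g = go (inside-or-outside v w x y z f)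
    where
    open Pentagon c renaming (zw to z≁w)
    wxyz = Pentagon.vwxy (turn c)
    hom : ∀ {u b} → Outside v w x y z u → adj U v u ≡ b → Homogeneous U v w x y z u b
    hom out vu = step⇒homogeneous (regular-step U uni reg) c out (flip U vu)
    module O = Outside oo
    module G = Outside og
    open Switch U (alternating o~g (Homogeneous.ux (hom og vg)) (flip U wx) (flip U (Homogeneous.uw (hom oo vo)))
                     G.≢x (O.≢w ∘ ≡-sym)) using (switched; switched-dg; off-row; zw′)
    S = switched
    ≢-sym : ∀ {a b : Fin n} → a ≢ b → b ≢ a
    ≢-sym = _∘ ≡-sym
    v-row = off-row (≢-sym O.≢v) (≢-sym G.≢v) (Path.a≢c vwxy) (edge-≢ U vw)
    y-row = off-row (≢-sym O.≢y) (≢-sym G.≢y) (edge-≢ U xy ∘ ≡-sym) (Path.b≢d vwxy ∘ ≡-sym)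
    z-row = off-row (≢-sym O.≢z) (≢-sym G.≢z) (Path.b≢d wxyz ∘ ≡-sym) (Path.a≢d wxyz ∘ ≡-sym)
    closed = path-closes S (Unigraph-transport U S uni switched-dg) (λ u → trans (switched-dg u) (reg u))
      (path (flip S (trans (y-row x) (flip U xy))) (trans (y-row z) yz) (trans (z-row v) zv)
            (flip S (trans (z-row x) (flip U xz))) (trans (y-row v) yv) (flip S (trans (v-row x) vx)))
    f = proj₁ closed
    module F = Pentagon (proj₂ closed)
    vf : adj U v f ≡ true
    vf = trans (≡-sym (v-row f)) F.yz
    go : (f ≡ v ⊎ f ≡ w ⊎ f ≡ x ⊎ f ≡ y ⊎ f ≡ z) ⊎ Outside v w x y z f → ⊥
    go (inj₁ (inj₁ e)) = edge-≢ U vf (≡-sym e)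
    go (inj₁ (inj₂ (inj₁ e))) = true≢false (trans (cong (λ u → adj S u x) (≡-sym e)) F.zv) (flip S zw′)
    go (inj₁ (inj₂ (inj₂ (inj₁ e)))) = true≢false (trans (cong (adj U v) (≡-sym e)) vf) vx
    go (inj₁ (inj₂ (inj₂ (inj₂ (inj₁ e))))) = true≢false (trans (cong (adj U v) (≡-sym e)) vf) (flip U yv)
    go (inj₁ (inj₂ (inj₂ (inj₂ (inj₂ e))))) =
      true≢false (trans (z-row y) (flip U yz)) (trans (cong (λ u → adj S u y) (≡-sym e)) F.zw)
    go (inj₂ out) = true≢false (trans (y-row f) (flip U (Homogeneous.uy (hom out vf)))) (flip S F.zw)

  -- By `no-far-edge` all neighbours of `u` are neighbours of `v`, and `w` is one more neighbour of
  -- `v`: against regularity.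
  far-empty : ∀ {v w x y z u} → Pentagon U v w x y z → Outside v w x y z u → adj U v u ≡ false → ⊥
  far-empty {v} {w} {x} {y} {z} {u} c out vu = <-irrefl (trans (reg u) (≡-sym (reg v)))
    (ℕ.≤-<-trans (count-mono sub) (subst (count (adj U v − w) <_) (≡-sym (count-− (adj U v) (Pentagon.vw c))) (n<1+n _)))
    where
    open Homogeneous (step⇒homogeneous (regular-step U uni reg) c out (flip U vu))
    sub : ∀ t → adj U u t ≡ true → (adj U v − w) t ≡ true
    sub t ut with ≡true? (adj U v t)
    ... | yes vt = trans (−-miss (adj U v) (col-≢ U ut uw)) vt
    ... | no ¬vt = ⊥-elim (no-far-edge c out
            (outside (col-≢ U ut uv) (col-≢ U ut uw) (col-≢ U ut ux) (col-≢ U ut uy) (col-≢ U ut uz)) vu (¬true⇒false ¬vt) ut)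

-- A vertex complete to the pentagon is anticomplete to the complementary pentagon, so both cases
-- are `far-empty`.
regular-pentagon-spans : ∀ {n} (U : Graph n) → Unigraph U → ∀ {r} → Regular U r →
                         ∀ {v w x y z u} → Pentagon U v w x y z → Outside v w x y z u → ⊥
regular-pentagon-spans U uni reg {v} {u = u} c out@(outside ≢v ≢w ≢x ≢y ≢z) with adj U v u in vu
... | false = far-empty U uni reg c out vu
... | true  = far-empty (co U) (co-unigraph U uni) (co-regular U reg v) (co-pentagon c)
                (outside ≢v ≢x ≢z ≢w ≢y) (co-adj U (≢v ∘ ≡-sym) vu)

-- Pentagons in an arbitrary unigraph

regular? : ∀ {n} (U : Graph n) p → Regular U p ⊎ ∃ λ v → dg U v ≢ p
regular? U p with all? (λ v → dg U v ℕ.≟ p)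
... | yes reg = inj₁ reg
... | no ¬reg with any? (λ v → ¬? (dg U v ℕ.≟ p))
...   | yes r = inj₂ r
...   | no ¬r = ⊥-elim (¬reg λ v → decidable-stable (dg U v ℕ.≟ p) (λ h → ¬r (v , h)))

module _ {n} (U : Graph n) (uni : Unigraph U) where
  private
    descent : ∀ {v w x y z} → Pentagon U v w x y z → dg U w < dg U v → dg U y < dg U x
    descent {v} {w} {x} {y} c w<v = ℕ.≰⇒> λ x≤y →
      <-irrefl (≡-sym (proj₁ (path-degrees U uni (Pentagon.vwxy c) (ℕ.<⇒≤ w<v) x≤y))) w<v

    -- A descent along one side forces one two sides further on. As five is odd, every side would
    -- descend all the way round.
    ascending : ∀ {v w x y z} → Pentagon U v w x y z → dg U v ≤ dg U w
    ascending {v} {w} {x} {y} {z} c = ≮⇒≥ λ w<v →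
      let y<x = descent c w<v
          v<z = descent (turn (turn c)) y<x
          x<w = descent (turn (turn (turn (turn c)))) v<z
          z<y = descent (turn c) x<w
      in <-irrefl refl (ℕ.<-trans v<z (ℕ.<-trans z<y (ℕ.<-trans y<x (ℕ.<-trans x<w w<v))))

  pentagon-degrees : ∀ {v w x y z} → Pentagon U v w x y z → dg U v ≡ dg U w
  pentagon-degrees c = ≤-antisym (ascending c)
    (≤-trans (ascending (turn c)) (≤-trans (ascending (turn (turn c)))
      (≤-trans (ascending (turn (turn (turn c)))) (ascending (turn (turn (turn (turn c))))))))

NearClique : ∀ {n} → Graph n → Set
NearClique G = ∀ {v w x y z u t} → Pentagon G v w x y z → Outside v w x y z u → Outside v w x y z t →
               adj G u v ≡ true → adj G t v ≡ true → u ≢ t → adj G u t ≡ true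

module _ {m n} (G : Graph n) (f : Fin m → Fin n) where
  private H = induce G f

  -- Membership is passed in this form so that matching on `refl` turns each vertex into some `f i`,
  -- where statements about `H` apply.
  Image : Fin n → Set
  Image v = ∃ λ i → f i ≡ v

  private
    pull-outside : ∀ {i j k l m s} → Outside (f i) (f j) (f k) (f l) (f m) (f s) → Outside i j k l m s
    pull-outside (outside a b c d e) =
      outside (a ∘ cong f) (b ∘ cong f) (c ∘ cong f) (d ∘ cong f) (e ∘ cong f)

    pull : ∀ {i j k l m} → Pentagon G (f i) (f j) (f k) (f l) (f m) → Pentagon H i j k l m
    pull (pentagon a b c d e a′ b′ c′ d′ e′) = pentagon a b c d e a′ b′ c′ d′ e′

  push : ∀ {i j k l m} → Pentagon H i j k l m → Pentagon G (f i) (f j) (f k) (f l) (f m)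
  push (pentagon a b c d e a′ b′ c′ d′ e′) = pentagon a b c d e a′ b′ c′ d′ e′

  lift-step : Step H → ∀ {v w x y z u} → Image v → Image w → Image x → Image y → Image z → Image u →
              Pentagon G v w x y z → Outside v w x y z u → adj G u v ≡ true → adj G u w ≡ true
  lift-step step (_ , refl) (_ , refl) (_ , refl) (_ , refl) (_ , refl) (_ , refl) c o =
    step (pull c) (pull-outside o)

  lift-near : NearClique H → ∀ {v w x y z u t} → Image v → Image w → Image x → Image y → Image z → Image u → Image t →
              Pentagon G v w x y z → Outside v w x y z u → Outside v w x y z t →
              adj G u v ≡ true → adj G t v ≡ true → u ≢ t → adj G u t ≡ true
  lift-near near (_ , refl) (_ , refl) (_ , refl) (_ , refl) (_ , refl) (_ , refl) (_ , refl) c o o′ uv tv u≢t =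
    near (pull c) (pull-outside o) (pull-outside o′) uv tv (u≢t ∘ cong f)

  lift-degrees : Unigraph H → ∀ {v w x y z} (v′ : Image v) (w′ : Image w) → Image x → Image y → Image z →
                 Pentagon G v w x y z → dg H (proj₁ v′) ≡ dg H (proj₁ w′)
  lift-degrees uni (_ , refl) (_ , refl) (_ , refl) (_ , refl) (_ , refl) c = pentagon-degrees H uni (pull c)

module PentagonClass {n} (U : Graph n) (uni : Unigraph U) {v w x y z : Fin n} (c : Pentagon U v w x y z) where
  p = dg U v
  K : Fin n → Bool
  K u = dg U u ≡ⁿ p
  en = enumerate K
  open Enumeration en public
  H = induce U at

  member : ∀ {u} → dg U u ≡ p → Image U at u
  member du = index _ (≡ⁿ-true du)

  dw : dg U w ≡ p
  dw = ≡-sym (pentagon-degrees U uni c)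
  dx : dg U x ≡ p
  dx = trans (≡-sym (pentagon-degrees U uni (turn c))) dw
  dy : dg U y ≡ p
  dy = trans (≡-sym (pentagon-degrees U uni (turn (turn c)))) dx
  dz : dg U z ≡ p
  dz = pentagon-degrees U uni (turn (turn (turn (turn c))))

  -- The class is itself a unigraph containing the pentagon, so `pentagon-degrees` holds there too.
  inner-degrees : within U K v ≡ within U K w
  inner-degrees = subst₂ (λ a b → within U K a ≡ within U K b) (proj₂ v′) (proj₂ w′)
    (trans (≡-sym (within-dg U en (proj₁ v′))) (trans
      (lift-degrees U at (class-unigraph U uni p en) v′ w′ (member dx) (member dy) (member dz) c)
      (within-dg U en (proj₁ w′))))
    where
    v′ = member refl
    w′ = member dw

-- Induction on the order. An outside vertex rules out that `U` is regular, so the degree class of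
-- the pentagon is strictly smaller; vertices of other degree are handled by switches against the
-- class.
pentagon-structure : ∀ N {n} → n ≤ N → (U : Graph n) → Unigraph U → Step U × NearClique U
pentagon-structure zero z≤n U uni = (λ { {()} }) , (λ { {()} })
pentagon-structure (suc N) {n} n≤N U uni = step , near
  where
  smaller : ∀ {v w x y z} (c : Pentagon U v w x y z) → let open PentagonClass U uni c in
            ∀ {u} → Outside v w x y z u → Step H × NearClique H
  smaller {v} c out with regular? U (dg U v)
  ... | inj₁ reg = ⊥-elim (regular-pentagon-spans U uni reg c out)
  ... | inj₂ (u , du) = pentagon-structure N (s≤s⁻¹ (<-≤-trans (size<n (≡ⁿ-false du)) n≤N)) H (class-unigraph U uni p en)
    where open PentagonClass U uni c

  step : Step U
  step {v} {w} {x} {y} {z} {u} c out uv with dg U u ℕ.≟ dg U v | ≡true? (adj U u w)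
  ... | _ | yes uw = uw
  ... | yes du | _ = lift-step U at (proj₁ (smaller c out)) (member refl) (member dw) (member dx) (member dy) (member dz)
                       (member du) c out uv
    where open PentagonClass U uni c
  -- The cycle w, x, v, u has just `u` outside the class and would make the inner degrees of `w` and
  -- `v` differ by one.
  ... | no du | no uw = ⊥-elim (1+n≢n (trans
          (≡-sym (class-degrees U uni p (alternating wx (flip U vx) (flip U uv) (¬true⇒false uw) (Path.a≢c vwxy ∘ ≡-sym) (Outside.≢w out))
                   dw dx refl du)) (≡-sym inner-degrees)))
    where
    open PentagonClass U uni c
    open Pentagon c

  -- With `t` outside the class, the inner degree of `u` must be one more than that of `x`. But `u`
  -- meets all neighbours of `x` in the class other than itself, and also `v`, `z` and `x`: at least
  -- two more.
  half : ∀ {v w x y z u t} → Pentagon U v w x y z → Outside v w x y z u → Outside v w x y z t →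
         adj U u v ≡ true → adj U t v ≡ true → u ≢ t → adj U u t ≡ false → dg U u ≡ dg U v → ⊥
  half {v} {w} {x} {y} {z} {u} {t} c ou ot uv tv u≢t ut du with dg U t ℕ.≟ dg U v
  ... | yes dt = true≢false
        (lift-near U at (proj₂ (smaller c ou)) (member refl) (member dw) (member dx) (member dy) (member dz)
                       (member du) (member dt) c ou ot uv tv u≢t) ut
    where open PentagonClass U uni c
  ... | no dt = ℕ.<-irrefl (trans (cong suc shrink) (trans (≡-sym inner) (≡-sym grow))) (s≤s (s≤s (s≤s (count-mono sub))))
    where
    open PentagonClass U uni c
    open Pentagon c
    module Hu = Homogeneous (step⇒homogeneous step c ou uv)
    P Q : Fin n → Bool
    P s = K s ∧ adj U x s
    Q s = K s ∧ adj U u s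
    inner : within U K u ≡ suc (within U K x)
    inner = class-degrees U uni p (alternating uv vx (flip U (Homogeneous.ux (step⇒homogeneous step c ot tv))) (flip U ut)
              (Path.a≢c vwxy) (u≢t ∘ ≡-sym)) du refl dx dt
    in-K : ∀ {s} {A : Fin n → Bool} → dg U s ≡ p → A s ≡ true → K s ∧ A s ≡ true
    in-K ds a = ∧-intro (≡ⁿ-true ds) a
    x≢v = Path.a≢c vwxy ∘ ≡-sym
    z≢v = edge-≢ U zv
    z≢x = Path.b≢d (Pentagon.vwxy (turn c)) ∘ ≡-sym
    P-u = P − u
    Q-v = Q − v
    Q-vz = Q-v − z
    Q-vzx = Q-vz − x
    grow : suc (suc (suc (count Q-vzx))) ≡ within U K u
    grow = ≡-sym (trans (count-− Q (in-K {A = adj U u} refl uv)) (cong suc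
      (trans (count-− Q-v (trans (−-miss Q z≢v) (in-K {A = adj U u} dz Hu.uz))) (cong suc
        (count-− Q-vz (trans (−-miss Q-v (z≢x ∘ ≡-sym)) (trans (−-miss Q x≢v) (in-K {A = adj U u} dx Hu.ux))))))))
    shrink : suc (count P-u) ≡ within U K x
    shrink = ≡-sym (count-− P (in-K {A = adj U x} du (flip U Hu.ux)))
    joined : ∀ s → K s ≡ true → adj U x s ≡ true → s ≢ u → adj U u s ≡ true
    joined s ks xs s≢u with inside-or-outside v w x y z s
    ... | inj₁ (inj₁ refl) = Hu.uv
    ... | inj₁ (inj₂ (inj₁ refl)) = Hu.uw
    ... | inj₁ (inj₂ (inj₂ (inj₁ refl))) = Hu.ux
    ... | inj₁ (inj₂ (inj₂ (inj₂ (inj₁ refl)))) = Hu.uy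
    ... | inj₁ (inj₂ (inj₂ (inj₂ (inj₂ refl)))) = Hu.uz
    ... | inj₂ os = lift-near U at (proj₂ (smaller c ou)) (member refl) (member dw) (member dx) (member dy) (member dz)
                      (member du) (member (≡ⁿ-sound ks)) c ou os uv sv (s≢u ∘ ≡-sym)
      where
      sv : adj U s v ≡ true
      sv = Homogeneous.uy (step⇒homogeneous step (turn (turn c)) (turn-outside (turn-outside os)) (flip U xs))
    sub : ∀ s → P-u s ≡ true → Q-vzx s ≡ true
    sub s h with Ps , s≢u ← −-true P h with ks , xs ← ∧-true {K s} Ps =
      trans (−-miss Q-vz (edge-≢ U xs ∘ ≡-sym)) (trans (−-miss Q-v (col-≢ U xs xz))
        (trans (−-miss Q (col-≢ U xs (flip U vx))) (∧-intro ks (joined s ks xs s≢u))))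

  near : NearClique U
  near {v} {w} {x} {y} {z} {u} {t} c ou ot uv tv u≢t with ≡true? (adj U u t)
  ... | yes ut = ut
  -- The cycle u, v, x, t gives `u` or `t` the degree of the pentagon, which is the assumption of
  -- `half`.
  ... | no ¬ut with ut ← ¬true⇒false ¬ut
               with alternating-degrees U uni (alternating uv (Pentagon.vx c)
                      (flip U (Homogeneous.ux (step⇒homogeneous step c ot tv))) (flip U ut) (Path.a≢c (Pentagon.vwxy c)) (u≢t ∘ ≡-sym))
  ...   | inj₁ u=x = ⊥-elim (half c ou ot uv tv u≢t ut (trans u=x (PentagonClass.dx U uni c)))
  ...   | inj₂ v=t = ⊥-elim (half c ot ou tv uv (u≢t ∘ ≡-sym) (flip U ut) (≡-sym v=t))

-- Perfect orders

record PerfectOrder {n} (G : Graph n) : Set where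
  field
    rank           : Fin n → ℕ
    rank-injective : ∀ {u v} → rank u ≡ rank v → u ≡ v
    unobstructed   : ∀ {a b c d} → Path G a b c d → rank a < rank b → rank d < rank c → ⊥

PentagonFree : ∀ {n} → Graph n → Set
PentagonFree G = ∀ {v w x y z} → ¬ Pentagon G v w x y z

order-⊑ : ∀ {m n} {H : Graph m} {G : Graph n} → H ⊑ind G → PerfectOrder G → PerfectOrder H
order-⊑ {H = H} {G} (f , inj , pres) O = record
  { rank = rank ∘ f
  ; rank-injective = λ {u} {v} e → inj u v (rank-injective e)
  ; unobstructed = λ (path ab bc cd ac bd ad) →
      unobstructed (path (image ab) (image bc) (image cd) (image ac) (image bd) (image ad)) }
  where
  open PerfectOrder O
  image : ∀ {u v b} → adj H u v ≡ b → adj G (f u) (f v) ≡ b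
  image {u} {v} e = trans (≡-sym (pres u v)) e

entry≤sum : ∀ {n} (f : Fin n → ℕ) i → f i ≤ sum f
entry≤sum f zero    = ℕ.m≤m+n (f zero) _
entry≤sum f (suc i) = ≤-trans (entry≤sum (f ∘ suc) i) (ℕ.m≤n+m _ (f zero))

module DegreeOrder {n} (U : Graph n) (uni : Unigraph U)
  (classes : ∀ p → PerfectOrder (induce U (Enumeration.at (enumerate (λ u → dg U u ≡ⁿ p))))) where

  module Class (p : ℕ) where
    open Enumeration (enumerate (λ u → dg U u ≡ⁿ p)) public
    open PerfectOrder (classes p) public

  place : ∀ v → ∃ λ i → Class.at (dg U v) i ≡ v
  place v = Class.index (dg U v) v (≡ⁿ-true refl)

  minor : Fin n → ℕ
  minor v = Class.rank (dg U v) (proj₁ (place v))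

  minor-class : ∀ {p i v} → dg U v ≡ p → Class.at p i ≡ v → minor v ≡ Class.rank p i
  minor-class {v = v} refl e = cong (Class.rank (dg U v)) (Class.at-inj (dg U v) (trans (proj₂ (place v)) (≡-sym e)))

  -- Exceeds every `minor`, so `degree-rank` is lexicographic: degree decides first, in decreasing
  -- order.
  B : ℕ
  B = suc (sum minor)

  degree-rank : Fin n → ℕ
  degree-rank v = (n ∸ dg U v) * B + minor v

  dg≤n : ∀ v → dg U v ≤ n
  dg≤n v = subst (dg U v ≤_) (co-dg U v) (ℕ.m≤m+n _ _)

  major : ∀ {u v} → dg U u < dg U v → degree-rank v < degree-rank u
  major {u} {v} lt = <-≤-trans (ℕ.+-monoʳ-< ((n ∸ dg U v) * B) (s≤s (entry≤sum minor v)))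
    (≤-trans (ℕ.≤-reflexive (ℕ.+-comm ((n ∸ dg U v) * B) B))
      (≤-trans (ℕ.*-monoˡ-≤ B (ℕ.∸-monoʳ-< lt (dg≤n v))) (ℕ.m≤m+n _ (minor u))))

  rank-dg : ∀ {u v} → degree-rank u < degree-rank v → dg U v ≤ dg U u
  rank-dg lt = ≮⇒≥ (λ u<v → ℕ.<-asym lt (major u<v))

  rank-minor : ∀ {u v} → dg U u ≡ dg U v → degree-rank u < degree-rank v → minor u < minor v
  rank-minor {u} {v} e lt = ℕ.+-cancelˡ-< ((n ∸ dg U v) * B) _ _
    (subst (λ d → (n ∸ d) * B + minor u < degree-rank v) e lt)

  degree-rank-injective : ∀ {u v} → degree-rank u ≡ degree-rank v → u ≡ v
  degree-rank-injective {u} {v} e with ℕ.<-cmp (dg U u) (dg U v)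
  ... | tri< lt _ _ = ⊥-elim (<-irrefl (≡-sym e) (major lt))
  ... | tri> _ _ gt = ⊥-elim (<-irrefl e (major gt))
  ... | tri≈ _ eq _ with i , refl ← Class.index (dg U v) u (≡ⁿ-true eq) = trans
        (cong (Class.at (dg U v)) (Class.rank-injective (dg U v)
          (trans (≡-sym (minor-class eq refl)) (ℕ.+-cancelˡ-≡ ((n ∸ dg U v) * B) _ _
            (subst (λ d → (n ∸ d) * B + minor u ≡ degree-rank v) eq e)))))
        (proj₂ (place v))

  degree-unobstructed : ∀ {a b c d} → Path U a b c d → degree-rank a < degree-rank b → degree-rank d < degree-rank c → ⊥
  degree-unobstructed {a} {b} {c} {d} P ab dc
    with a=b , b=c , c=d ← path-degrees U uni P (rank-dg ab) (rank-dg dc) =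
    go (in-class refl) (in-class (≡-sym a=b)) (in-class (≡-sym (trans a=b b=c))) (in-class (≡-sym (trans a=b (trans b=c c=d))))
      P refl (≡-sym a=b) (≡-sym (trans a=b b=c)) (≡-sym (trans a=b (trans b=c c=d)))
      (rank-minor a=b ab) (rank-minor (≡-sym c=d) dc)
    where
    p = dg U a
    in-class : ∀ {u} → dg U u ≡ p → ∃ λ i → Class.at p i ≡ u
    in-class e = Class.index p _ (≡ⁿ-true e)
    go : ∀ {a b c d} → (∃ λ i → Class.at p i ≡ a) → (∃ λ i → Class.at p i ≡ b) → (∃ λ i → Class.at p i ≡ c) →
         (∃ λ i → Class.at p i ≡ d) → Path U a b c d →
         dg U a ≡ p → dg U b ≡ p → dg U c ≡ p → dg U d ≡ p → minor a < minor b → minor d < minor c → ⊥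
    go (_ , refl) (_ , refl) (_ , refl) (_ , refl) (path ab bc cd ac bd ad) da db dc dd a<b d<c =
      Class.unobstructed p (path ab bc cd ac bd ad)
        (subst₂ _<_ (minor-class da refl) (minor-class db refl) a<b)
        (subst₂ _<_ (minor-class dd refl) (minor-class dc refl) d<c)

  degree-order : PerfectOrder U
  degree-order = record
    { rank = degree-rank ; rank-injective = degree-rank-injective ; unobstructed = degree-unobstructed }

pentagon-free-order : ∀ N {n} → n ≤ N → (U : Graph n) → Unigraph U → PentagonFree U → PerfectOrder U
pentagon-free-order _ {zero} _ U uni free = record
  { rank = λ () ; rank-injective = λ { {()} } ; unobstructed = λ { {()} } }
pentagon-free-order (suc N) {suc n} n≤N U uni free with regular? U (dg U zero)
-- An induced path would close up to a pentagon; there is none, and any injective rank will do.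
... | inj₁ reg = record
  { rank = toℕ ; rank-injective = toℕ-injective
  ; unobstructed = λ P _ _ → free (proj₂ (path-closes U uni reg P)) }
... | inj₂ (v , v≁0) = DegreeOrder.degree-order U uni λ p →
  let en = enumerate (λ u → dg U u ≡ⁿ p)
      open Enumeration en
  in pentagon-free-order N (s≤s⁻¹ (<-≤-trans (size<n (≡ⁿ-false (proj₂ (other p)))) n≤N))
       (induce U at) (class-unigraph U uni p en) (free ∘ push U at)
  where
  other : ∀ p → ∃ λ u → dg U u ≢ p
  other p with dg U zero ℕ.≟ p
  ... | yes 0≡p = v , λ v≡p → v≁0 (trans v≡p (≡-sym 0≡p))
  ... | no 0≢p  = zero , 0≢p

-- Deleting a vertex of a pentagon

pentagon? : ∀ {n} (G : Graph n) → (∃ λ v → ∃ λ w → ∃ λ x → ∃ λ y → ∃ λ z → Pentagon G v w x y z) ⊎ PentagonFree G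
pentagon? {n} G with any? (λ v → any? λ w → any? λ x → any? λ y → any? (is-pentagon v w x y))
  where
  is-pentagon : ∀ v w x y z → Dec (Pentagon G v w x y z)
  is-pentagon v w x y z = map′ (λ ((((a , b) , (c , d)) , e) , (((a′ , b′) , (c′ , d′)) , e′)) → pentagon a b c d e a′ b′ c′ d′ e′)
    (λ (pentagon a b c d e a′ b′ c′ d′ e′) → ((((a , b) , (c , d)) , e) , (((a′ , b′) , (c′ , d′)) , e′)))
    (((((t v w) ×-dec (t w x)) ×-dec ((t x y) ×-dec (t y z))) ×-dec t z v)
      ×-dec ((((f v x) ×-dec (f w y)) ×-dec ((f x z) ×-dec (f y v))) ×-dec f z w))
    where
    t : ∀ i j → Dec (adj G i j ≡ true)
    t i j = adj G i j Data.Bool.≟ true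
    f : ∀ i j → Dec (adj G i j ≡ false)
    f i j = adj G i j Data.Bool.≟ false
... | yes found = inj₁ found
... | no none   = inj₂ λ c → none (_ , _ , _ , _ , _ , c)

-- The clique precedes the independent set. An end of an induced path misses two adjacent vertices,
-- so it cannot lie in the clique; its neighbour on the path then does and comes first.
split-order : ∀ {n} (G : Graph n) (K : Fin n → Bool) →
              (∀ {u v} → K u ≡ true → K v ≡ true → u ≢ v → adj G u v ≡ true) →
              (∀ {u v} → K u ≡ false → K v ≡ false → adj G u v ≡ false) → PerfectOrder G
split-order {n} G K clique indep = record
  { rank = split-rank ; rank-injective = λ {u} {v} → inj {u} {v}
  ; unobstructed = λ P a<b _ → late-end P a<b }
  where
  split-rank : Fin n → ℕ
  split-rank u = if K u then toℕ u else n + toℕ u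
  inj : ∀ {u v} → split-rank u ≡ split-rank v → u ≡ v
  inj {u} {v} e with K u | K v
  ... | true  | true  = toℕ-injective e
  ... | false | false = toℕ-injective (ℕ.+-cancelˡ-≡ n _ _ e)
  ... | true  | false = ⊥-elim (ℕ.<⇒≱ (toℕ<n u) (subst (n ≤_) (≡-sym e) (ℕ.m≤m+n n _)))
  ... | false | true  = ⊥-elim (ℕ.<⇒≱ (toℕ<n v) (subst (n ≤_) e (ℕ.m≤m+n n _)))
  no-end : ∀ {a b c d} → Path G a b c d → K a ≡ true → ⊥
  no-end {a} {b} {c} {d} P ka = true≢false cd (indep (out ac a≢c) (out ad a≢d))
    where
    open Path P
    out : ∀ {u} → adj G a u ≡ false → a ≢ u → K u ≡ false
    out au a≢u = ¬true⇒false λ ku → true≢false (clique ka ku a≢u) au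
  late-end : ∀ {a b c d} → Path G a b c d → split-rank a < split-rank b → ⊥
  late-end {a} {b} P a<b with ka ← ¬true⇒false (no-end P) with K b in kb
  ... | false = true≢false (Path.ab P) (indep ka kb)
  ... | true rewrite ka = ℕ.<⇒≱ (toℕ<n b) (≤-trans (ℕ.m≤m+n n (toℕ a)) (ℕ.<⇒≤ a<b))

-- Without v, the pentagon vwxyz is the path wxyz, which is split with clique {x,y}; the
-- vertices complete to the pentagon enlarge the clique and the others the independent set.
module PentagonSplit {n} (U : Graph n) (uni : Unigraph U) {v w x y z} (c : Pentagon U v w x y z) where
  open Pentagon c
  private
    structure = pentagon-structure n ℕ.≤-refl U uni
    co-structure = pentagon-structure n ℕ.≤-refl (co U) (co-unigraph U uni)

  Inner Outer : Fin n → Set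
  Inner u = u ≡ x ⊎ u ≡ y ⊎ (Outside v w x y z u × adj U u v ≡ true)
  Outer u = u ≡ w ⊎ u ≡ z ⊎ (Outside v w x y z u × adj U u v ≡ false)

  inner-or-outer : ∀ u → u ≢ v → Inner u ⊎ Outer u
  inner-or-outer u u≢v with inside-or-outside v w x y z u
  ... | inj₁ (inj₁ e) = ⊥-elim (u≢v e)
  ... | inj₁ (inj₂ (inj₁ e)) = inj₂ (inj₁ e)
  ... | inj₁ (inj₂ (inj₂ (inj₁ e))) = inj₁ (inj₁ e)
  ... | inj₁ (inj₂ (inj₂ (inj₂ (inj₁ e)))) = inj₁ (inj₂ (inj₁ e))
  ... | inj₁ (inj₂ (inj₂ (inj₂ (inj₂ e)))) = inj₂ (inj₂ (inj₁ e))
  ... | inj₂ o with adj U u v in uv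
  ...   | true  = inj₁ (inj₂ (inj₂ (o , refl)))
  ...   | false = inj₂ (inj₂ (inj₂ (o , refl)))

  private
    hom : ∀ {u b} → Outside v w x y z u × adj U u v ≡ b → Homogeneous U v w x y z u b
    hom (o , uv) = step⇒homogeneous (proj₁ structure) c o uv

  inner-clique : ∀ {u t} → Inner u → Inner t → u ≢ t → adj U u t ≡ true
  inner-clique (inj₁ refl) (inj₁ refl) u≢t = ⊥-elim (u≢t refl)
  inner-clique (inj₁ refl) (inj₂ (inj₁ refl)) _ = xy
  inner-clique (inj₁ refl) (inj₂ (inj₂ o)) _ = flip U (Homogeneous.ux (hom o))
  inner-clique (inj₂ (inj₁ refl)) (inj₁ refl) _ = flip U xy
  inner-clique (inj₂ (inj₁ refl)) (inj₂ (inj₁ refl)) u≢t = ⊥-elim (u≢t refl)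
  inner-clique (inj₂ (inj₁ refl)) (inj₂ (inj₂ o)) _ = flip U (Homogeneous.uy (hom o))
  inner-clique (inj₂ (inj₂ o)) (inj₁ refl) _ = Homogeneous.ux (hom o)
  inner-clique (inj₂ (inj₂ o)) (inj₂ (inj₁ refl)) _ = Homogeneous.uy (hom o)
  inner-clique (inj₂ (inj₂ (o , uv))) (inj₂ (inj₂ (o′ , tv))) u≢t = proj₂ structure c o o′ uv tv u≢t

  private
    far : ∀ {u t} → Outside v w x y z u → Outside v w x y z t → adj U u v ≡ false → adj U t v ≡ false → adj U u t ≡ false
    far {u} {t} o o′ uv tv with eq? u t | ≡true? (adj U u t)
    ... | inj₁ refl | _ = irrefl U u
    ... | inj₂ _ | no ¬ut = ¬true⇒false ¬ut
    ... | inj₂ u≢t | yes ut = ⊥-elim (true≢false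
          (proj₂ co-structure (co-pentagon c) (co-outside o) (co-outside o′)
            (co-adj U (Outside.≢v o) uv) (co-adj U (Outside.≢v o′) tv) u≢t)
          (co-adj U u≢t ut))
      where
      co-outside : ∀ {u} → Outside v w x y z u → Outside v x z w y u
      co-outside (outside a b c d e) = outside a c e b d

  outer-independent : ∀ {u t} → Outer u → Outer t → adj U u t ≡ false
  outer-independent (inj₁ refl) (inj₁ refl) = irrefl U w
  outer-independent (inj₁ refl) (inj₂ (inj₁ refl)) = flip U zw
  outer-independent (inj₁ refl) (inj₂ (inj₂ o)) = flip U (Homogeneous.uw (hom o))
  outer-independent (inj₂ (inj₁ refl)) (inj₁ refl) = zw
  outer-independent (inj₂ (inj₁ refl)) (inj₂ (inj₁ refl)) = irrefl U z
  outer-independent (inj₂ (inj₁ refl)) (inj₂ (inj₂ o)) = flip U (Homogeneous.uz (hom o))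
  outer-independent (inj₂ (inj₂ o)) (inj₁ refl) = Homogeneous.uw (hom o)
  outer-independent (inj₂ (inj₂ o)) (inj₂ (inj₁ refl)) = Homogeneous.uz (hom o)
  outer-independent (inj₂ (inj₂ (o , uv))) (inj₂ (inj₂ (o′ , tv))) = far o o′ uv tv

  avoiding-order : ∀ {m} {H : Graph m} ((f , _) : H ⊑ind U) → (∀ i → f i ≢ v) → PerfectOrder H
  avoiding-order {m} {H} (f , inj , pres) avoid = split-order H K
    (λ {i} {j} ki kj i≢j → trans (pres i j) (inner-clique (K-true i ki) (K-true j kj) (i≢j ∘ inj i j)))
    (λ {i} {j} ki kj → trans (pres i j) (outer-independent (K-false i ki) (K-false j kj)))
    where
    side : ∀ i → Inner (f i) ⊎ Outer (f i)
    side i = inner-or-outer (f i) (avoid i)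
    left : ∀ {A B : Set} → A ⊎ B → Bool
    left (inj₁ _) = true
    left (inj₂ _) = false
    K : Fin m → Bool
    K i = left (side i)
    K-true : ∀ i → K i ≡ true → Inner (f i)
    K-true i k with side i
    ... | inj₁ p = p
    K-false : ∀ i → K i ≡ false → Outer (f i)
    K-false i k with side i
    ... | inj₂ p = p

-- If `G` contains the chosen pentagon vertex `v`, that vertex is deleted; if not, or if there is no
-- pentagon, the whole of `G` already has such an order and vertex `zero` is deleted.
apex-order : ∀ {m n} (U : Graph m) → Unigraph U → (G : Graph (suc n)) → G ⊑ind U → ∃ λ v → PerfectOrder (delete G v)
apex-order {m} U uni G (f , inj , pres) = go (pentagon? U)
  where
  sub : ∀ v → delete G v ⊑ind U
  sub v = f ∘ punchIn v , (λ i j e → punchIn-injective v i j (inj _ _ e)) , λ i j → pres _ _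
  go : (∃ λ v → ∃ λ w → ∃ λ x → ∃ λ y → ∃ λ z → Pentagon U v w x y z) ⊎ PentagonFree U →
       ∃ λ v → PerfectOrder (delete G v)
  go (inj₂ free) = zero , order-⊑ (sub zero) (pentagon-free-order m ℕ.≤-refl U uni free)
  go (inj₁ (v , w , x , y , z , c)) with any? (λ i → f i ≟ v)
  ... | yes (i , fi) = i , PentagonSplit.avoiding-order U uni c (sub i) (λ j e → punchInᵢ≢i i j (inj _ _ (trans e (≡-sym fi))))
  ... | no ¬i = zero , PentagonSplit.avoiding-order U uni c (sub zero) (λ j e → ¬i (_ , e))

-- Chvátal's theorem

argmin : ∀ {k} (f : Fin (suc k) → ℕ) → ∃ λ i → ∀ j → f i ≤ f j
argmin {zero}  f = zero , λ { zero → ≤-refl }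
argmin {suc k} f with argmin (f ∘ suc)
... | i , h with ≤-total (f zero) (f (suc i))
...   | inj₁ le = zero , λ { zero → ≤-refl ; (suc j) → ≤-trans le (h j) }
...   | inj₂ ge = suc i , λ { zero → ge ; (suc j) → h j }

argmax : ∀ {k} (f : Fin (suc k) → ℕ) → ∃ λ i → ∀ j → f j ≤ f i
argmax {zero}  f = zero , λ { zero → ≤-refl }
argmax {suc k} f with argmax (f ∘ suc)
... | i , h with ≤-total (f zero) (f (suc i))
...   | inj₂ ge = zero , λ { zero → ≤-refl ; (suc j) → ≤-trans (h j) ge }
...   | inj₁ le = suc i , λ { zero → le ; (suc j) → h j }

module _ {n} (G : Graph n) (O : PerfectOrder G) where
  open PerfectOrder O

  Clique : ∀ {k} → (Fin k → Fin n) → Set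
  Clique q = ∀ {i j} → i ≢ j → adj G (q i) (q j) ≡ true

  -- Chvátal's lemma. If no p i worked, induction would make each p (σ w) miss exactly q w, for a
  -- permutation σ; the earliest p a, with a = σ y, and p y then end an obstructed path.
  common-neighbour : ∀ k (q p : Fin (suc k) → Fin n) → Clique q → (∀ i → adj G (p i) (q i) ≡ true) →
                     (∀ i → rank (p i) < rank (q i)) → (∀ i j → adj G (p i) (p j) ≡ false) →
                     ∃ λ i → ∀ j → adj G (p i) (q j) ≡ true
  common-neighbour zero q p clique pq before stable = zero , λ { zero → pq zero }
  common-neighbour (suc k) q p clique pq before stable = decide (any? (λ w → adj G (p (σ w)) (q w) Bool.≟ true))
    where
    smaller : ∀ w → ∃ λ i → ∀ j → adj G (p (punchIn w i)) (q (punchIn w j)) ≡ true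
    smaller w = common-neighbour k (q ∘ punchIn w) (p ∘ punchIn w)
      (λ i≢j → clique (i≢j ∘ punchIn-injective w _ _)) (pq ∘ punchIn w) (before ∘ punchIn w) (λ i j → stable _ _)
    σ : Fin (suc (suc k)) → Fin (suc (suc k))
    σ w = punchIn w (proj₁ (smaller w))
    covers : ∀ {w x} → x ≢ w → adj G (p (σ w)) (q x) ≡ true
    covers {w} x≢w = trans (cong (λ t → adj G (p (σ w)) (q t)) (≡-sym (punchIn-punchOut (x≢w ∘ ≡-sym))))
                           (proj₂ (smaller w) _)
    decide : Dec (∃ λ w → adj G (p (σ w)) (q w) ≡ true) → ∃ λ i → ∀ j → adj G (p i) (q j) ≡ true
    decide (yes (w , h)) = σ w , λ j → all j (eq? j w)
      where
      all : ∀ j → j ≡ w ⊎ j ≢ w → adj G (p (σ w)) (q j) ≡ true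
      all j (inj₁ refl) = h
      all j (inj₂ j≢w) = covers j≢w
    decide (no none) = ⊥-elim (unobstructed
        (path (trans (cong (λ t → adj G (p t) (q x)) (≡-sym σy)) (covers x≢y)) (clique x≢y) (flip G (pq y))
              (trans (cong (λ t → adj G (p t) (q y)) (≡-sym σy)) (misses y))
              (flip G (trans (cong (λ t → adj G (p t) (q x)) (≡-sym σx)) (misses x))) (stable a y))
        (≤-<-trans (proj₂ (argmin (rank ∘ p)) x) (before x)) (before y))
      where
      misses : ∀ w → adj G (p (σ w)) (q w) ≡ false
      misses w = ¬true⇒false (λ h → none (w , h))
      σ-injective : ∀ {w w′} → σ w ≡ σ w′ → w ≡ w′
      σ-injective {w} {w′} e with eq? w w′
      ... | inj₁ w≡w′ = w≡w′
      ... | inj₂ w≢w′ = ⊥-elim (true≢false (trans (cong (λ t → adj G (p t) (q w)) e) (covers w≢w′)) (misses w))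
      a = proj₁ (argmin (rank ∘ p))
      y = proj₁ (injective⇒surjective σ σ-injective a)
      σy = proj₂ (injective⇒surjective σ σ-injective a)
      x = proj₁ (injective⇒surjective σ σ-injective y)
      σx = proj₂ (injective⇒surjective σ σ-injective y)
      x≢y : x ≢ y
      x≢y x≡y = punchInᵢ≢i x (proj₁ (smaller x)) (trans σx (≡-sym x≡y))

  -- Only vertices of rank below `t` are constrained, which lets the colouring be built rank by
  -- rank.
  record GreedyColouring (t : ℕ) : Set where
    field
      colour : Fin n → ℕ
      proper : ∀ {u v} → rank u < t → rank v < t → adj G u v ≡ true → colour u ≢ colour v
      greedy : ∀ {v} → rank v < t → ∀ {i} → i < colour v → ∃ λ u → adj G v u ≡ true × rank u < rank v × colour u ≡ i

least-missing : ∀ {P : ℕ → Set} → (∀ i → Dec (P i)) → ∀ N → ¬ P N → ∃ λ c → ¬ P c × (∀ {i} → i < c → P i)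
least-missing {P} P? N ¬PN = finish (search N)
  where
  search : ∀ N → (∀ {i} → i < N → P i) ⊎ ∃ λ c → ¬ P c × (∀ {i} → i < c → P i)
  search zero = inj₁ λ ()
  search (suc N) with search N | P? N
  ... | inj₂ found | _ = inj₂ found
  ... | inj₁ below | no ¬p = inj₂ (N , ¬p , below)
  ... | inj₁ below | yes p = inj₁ λ {i} i<sN → extend i (i ℕ.≟ N) (s≤s⁻¹ i<sN)
    where
    extend : ∀ i → Dec (i ≡ N) → i ≤ N → P i
    extend i (yes refl) _ = p
    extend i (no i≢N) i≤N = below (≤∧≢⇒< i≤N i≢N)
  finish : (∀ {i} → i < N → P i) ⊎ (∃ λ c → ¬ P c × (∀ {i} → i < c → P i)) → ∃ λ c → ¬ P c × (∀ {i} → i < c → P i)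
  finish (inj₁ below) = N , ¬PN , below
  finish (inj₂ found) = found

module _ {n} (G : Graph n) (O : PerfectOrder G) where
  open PerfectOrder O
  open GreedyColouring

  greedy-colouring : ∀ t → GreedyColouring G O t
  greedy-colouring zero = record { colour = λ _ → 0 ; proper = λ () ; greedy = λ () }
  greedy-colouring (suc t) with greedy-colouring t | any? (λ v → rank v ℕ.≟ t)
  ... | C | no none = record
    { colour = colour C
    ; proper = λ u<t v<t → proper C (below u<t) (below v<t)
    ; greedy = λ v<t → greedy C (below v<t) }
    where
    below : ∀ {u} → rank u < suc t → rank u < t
    below {u} u<st = ≤∧≢⇒< (s≤s⁻¹ u<st) (λ e → none (u , e))
  ... | C | yes (v , refl) = record { colour = colour′ ; proper = proper′ _ _ ; greedy = greedy′ _ }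
    where
    Used : ℕ → Set
    Used i = ∃ λ u → (adj G v u ≡ true × rank u < rank v) × colour C u ≡ i
    used? : ∀ i → Dec (Used i)
    used? i = any? (λ u → ((adj G v u Bool.≟ true) ×-dec (rank u ℕ.<? rank v)) ×-dec (colour C u ℕ.≟ i))
    missing = least-missing used? (suc (sum (colour C)))
      (λ (u , _ , e) → ℕ.<⇒≱ ≤-refl (subst (_≤ sum (colour C)) e (entry≤sum (colour C) u)))
    c = proj₁ missing
    colour′ : Fin n → ℕ
    colour′ u = if u == v then c else colour C u
    at-v : colour′ v ≡ c
    at-v rewrite ==-refl v = refl
    off-v : ∀ {u} → u ≢ v → colour′ u ≡ colour C u
    off-v u≢v rewrite ==-≢ u≢v = refl
    below : ∀ {u} → rank u < suc (rank v) → u ≢ v → rank u < rank v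
    below u<sv u≢v = ≤∧≢⇒< (s≤s⁻¹ u<sv) (u≢v ∘ rank-injective)
    earlier-≢ : ∀ {u} → rank u < rank v → u ≢ v
    earlier-≢ lt refl = <-irrefl refl lt
    new : ∀ {u} → rank u < rank v → adj G v u ≡ true → colour C u ≢ c
    new lt vu e = proj₁ (proj₂ missing) (_ , (vu , lt) , e)
    proper′ : ∀ u w → rank u < suc (rank v) → rank w < suc (rank v) → adj G u w ≡ true → colour′ u ≢ colour′ w
    proper′ u w u≤v w≤v uw e with eq? u v | eq? w v
    ... | inj₁ refl | inj₁ refl = edge-≢ G uw refl
    ... | inj₁ refl | inj₂ w≢v = new (below w≤v w≢v) uw (trans (≡-sym (off-v w≢v)) (trans (≡-sym e) at-v))
    ... | inj₂ u≢v | inj₁ refl = new (below u≤v u≢v) (flip G uw) (trans (≡-sym (off-v u≢v)) (trans e at-v))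
    ... | inj₂ u≢v | inj₂ w≢v =
          proper C (below u≤v u≢v) (below w≤v w≢v) uw (trans (≡-sym (off-v u≢v)) (trans e (off-v w≢v)))
    greedy′ : ∀ w → rank w < suc (rank v) → ∀ {i} → i < colour′ w →
              ∃ λ u → adj G w u ≡ true × rank u < rank w × colour′ u ≡ i
    greedy′ w w≤v {i} i<c with eq? w v
    ... | inj₁ refl with u , (vu , lt) , e ← proj₂ (proj₂ missing) (subst (i <_) at-v i<c) =
          u , vu , lt , trans (off-v (earlier-≢ lt)) e
    ... | inj₂ w≢v with u , wu , lt , e ← greedy C (below w≤v w≢v) (subst (i <_) (off-v w≢v) i<c) =
          u , wu , lt , trans (off-v (earlier-≢ (<-trans lt (below w≤v w≢v)))) e

clique-injective : ∀ {n} (G : Graph n) {k} (q : Fin k → Fin n) → (∀ {i j} → i ≢ j → adj G (q i) (q j) ≡ true) →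
                   ∀ i j → q i ≡ q j → i ≡ j
clique-injective G q clique i j e with eq? i j
... | inj₁ i≡j = i≡j
... | inj₂ i≢j = ⊥-elim (edge-≢ G (clique i≢j) e)

-- A vertex of the greatest colour `M` is extended downwards to a clique with one vertex in each of
-- the `suc M` colours.
perfect-order-optimal : ∀ {n} (G : Graph n) → PerfectOrder G → ∃ λ k → HasClique G k × Colorable G k
perfect-order-optimal {zero} G O = 0 , ((λ ()) , (λ ()) , λ ()) , ((λ ()) , λ ())
perfect-order-optimal {suc n} G O = suc M , subst (HasClique G) (ℕ.+-comm M 1) clique , (col , proper-col)
  where
  open PerfectOrder O
  C = greedy-colouring G O (suc (sum rank))
  open GreedyColouring C
  top = proj₁ (argmax colour)
  M = colour top
  ranked : ∀ {u} → rank u < suc (sum rank)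
  ranked {u} = s≤s (entry≤sum rank u)
  bounded : ∀ u → colour u < suc M
  bounded u = s≤s (proj₂ (argmax colour) u)
  col : Fin (suc n) → Fin (suc M)
  col u = fromℕ< (bounded u)
  proper-col : ∀ i j → adj G i j ≡ true → col i ≢ col j
  proper-col i j ij e = proper ranked ranked ij
    (trans (≡-sym (toℕ-fromℕ< (bounded i))) (trans (cong toℕ e) (toℕ-fromℕ< (bounded j))))
  -- Greediness gives each clique member an earlier neighbour of the next lower colour. Sharing a
  -- colour, these are pairwise nonadjacent, so `common-neighbour` makes one of them adjacent to the
  -- whole clique.
  extend : ∀ s {k} (q : Fin (suc k) → Fin (suc n)) → Clique G O q → (∀ i → s ≤ colour (q i)) → HasClique G (s + suc k)
  extend zero q clique _ = q , clique-injective G q clique , λ i j → clique {i} {j}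
  extend (suc s) {k} q clique above = subst (HasClique G) (ℕ.+-suc s (suc k)) (extend s q⁺ clique⁺ above⁺)
    where
    pred : ∀ i → ∃ λ u → adj G (q i) u ≡ true × rank u < rank (q i) × colour u ≡ s
    pred i = greedy ranked (above i)
    p = proj₁ ∘ pred
    same : ∀ i → colour (p i) ≡ s
    same i = proj₂ (proj₂ (proj₂ (pred i)))
    joined = common-neighbour G O k q p clique (λ i → flip G (proj₁ (proj₂ (pred i)))) (λ i → proj₁ (proj₂ (proj₂ (pred i))))
      (λ i j → ¬true⇒false λ e → proper ranked ranked e (trans (same i) (≡-sym (same j))))
    q⁺ : Fin (suc (suc k)) → Fin (suc n)
    q⁺ zero    = p (proj₁ joined)
    q⁺ (suc i) = q i
    clique⁺ : Clique G O q⁺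
    clique⁺ {zero}  {zero}  ne = ⊥-elim (ne refl)
    clique⁺ {zero}  {suc j} ne = proj₂ joined j
    clique⁺ {suc i} {zero}  ne = flip G (proj₂ joined i)
    clique⁺ {suc i} {suc j} ne = clique (ne ∘ cong suc)
    above⁺ : ∀ i → s ≤ colour (q⁺ i)
    above⁺ zero    = ℕ.≤-reflexive (≡-sym (same _))
    above⁺ (suc i) = ≤-trans (ℕ.n≤1+n s) (above i)
  clique : HasClique G (M + 1)
  clique = extend M {0} (λ _ → top) (λ { {zero} {zero} ne → ⊥-elim (ne refl) }) (λ _ → ≤-refl)

-- Perfection and the chromatic bound

clique≤colours : ∀ {n} (G : Graph n) {a b} → HasClique G a → Colorable G b → a ≤ b
clique≤colours G (q , _ , clique) (col , proper) = injective⇒≤ {f = col ∘ q} inj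
  where
  inj : ∀ {i j} → col (q i) ≡ col (q j) → i ≡ j
  inj {i} {j} e with eq? i j
  ... | inj₁ i≡j = i≡j
  ... | inj₂ i≢j = ⊥-elim (proper _ _ (clique i j i≢j) e)

perfect-order⇒perfect : ∀ {n} (G : Graph n) → PerfectOrder G → Perfect G
perfect-order⇒perfect G O k H sub a b (clique , max) (colouring , min)
  with c , c-clique , c-colouring ← perfect-order-optimal H (order-⊑ sub O) =
  ≤-antisym (clique≤colours H clique colouring) (≤-trans (min c c-colouring) (max c c-clique))

clique-undelete : ∀ {n} (G : Graph (suc n)) v {k} → HasClique (delete G v) k → HasClique G k
clique-undelete G v (q , inj , clique) =
  punchIn v ∘ q , (λ i j e → inj i j (punchIn-injective v _ _ e)) , clique

colour-undelete : ∀ {n} (G : Graph (suc n)) v {k} → Colorable (delete G v) k → Colorable G (suc k)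
colour-undelete {n} G v {k} (col , proper) = (λ u → shade u (v ≟ u)) , λ i j ij → differ (v ≟ i) (v ≟ j) ij
  where
  shade : ∀ u → Dec (v ≡ u) → Fin (suc k)
  shade u (yes _)  = zero
  shade u (no v≢u) = suc (col (punchOut v≢u))
  differ : ∀ {i j} (p : Dec (v ≡ i)) (q : Dec (v ≡ j)) → adj G i j ≡ true → shade i p ≢ shade j q
  differ (yes refl) (yes refl) ij _ = edge-≢ G ij refl
  differ (yes _) (no _) ij ()
  differ (no _) (yes _) ij ()
  differ (no v≢i) (no v≢j) ij e = proper (punchOut v≢i) (punchOut v≢j)
    (trans (cong₂ (adj G) (punchIn-punchOut v≢i) (punchIn-punchOut v≢j)) ij) (Fin-suc-injective e)

theorem3p2 : ∀ (n m : ℕ) (U : Graph m) (G : Graph (suc n)) →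
    Unigraph U → G ⊑ind U →
    ApexPerfect G ×
    (∀ a b → IsCliqueNumber G a → IsChromaticNumber G b → b ≤ a + 1)
theorem3p2 n m U G uni sub with v , O ← apex-order U uni G sub =
  (v , perfect-order⇒perfect (delete G v) O) , bound
  where
  bound : ∀ a b → IsCliqueNumber G a → IsChromaticNumber G b → b ≤ a + 1
  -- The same `k` is a clique size and a number of colours of `delete G v`; restoring `v` costs one
  -- fresh colour.
  bound a b (_ , max) (_ , min) with k , clique , colouring ← perfect-order-optimal (delete G v) O =
    ≤-trans (min (suc k) (colour-undelete G v colouring))
      (subst (suc k ≤_) (ℕ.+-comm 1 a) (s≤s (max k (clique-undelete G v clique))))
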